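{- Let $N\ge9$ and let $C$ be an admissible linear code of length $5$ over $\mathbb{Z}_N$ that can be generated by a matrix with $m=2$ rows. Suppose $C$ is non-degenerate and not a direct sum. Then $C$ is thin if and only if $N$ is even and, up to isomorphism, the generating matrix of $C$ can be chosen as $$g=\begin{pmatrix}N/2&N/2&0&0&0\\N/2&0&N/2&1&N-1\end{pmatrix}.$$
   Context: $\mathbb{Z}_N=\mathbb{Z}/N\mathbb{Z}$, with elements identified with the representatives $0,\dots,N-1$. A linear code of length $n$ over $\mathbb{Z}_N$ is a submodule of $\mathbb{Z}_N^n$; its elements are words; a generating matrix is a matrix whose rows generate it. It is extended if all words have coordinate sum $0\bmod N$. Call a linear code over $\mathbb{Z}_N$ admissible if it is extended and the greatest common divisor of $N$ and all entries of all words is $1$. It is degenerate if some coordinate is zero in all words. An extended code is thin if it contains no word with all entries nonzero. Two codes over the same $\mathbb{Z}_N$ and of the same length are isomorphic if they coincide after a permutation of coordinates. Direct sum: for codes $C_1$ over $\mathbb{Z}_{N_1}$ and $C_2$ over $\mathbb{Z}_{N_2}$, of lengths $\ge1$, with $L=\operatorname{lcm}(N_1,N_2)$, $C_1\oplus C_2$ is the code over $\mathbb{Z}_L$ consisting of all concatenations $\frac{L}{N_1}c_1\,|\,\frac{L}{N_2}c_2$, $c_1\in C_1$, $c_2\in C_2$. A code is a direct sum if it is isomorphic to some $C_1\oplus C_2$. -}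

module Defs where

open import Level using (0ℓ)
open import Data.Fin.Base using (Fin; toℕ)
open import Data.Fin.Permutation using (Permutation′; _⟨$⟩ʳ_)
open import Data.Nat.Base using (ℕ; NonZero; ≢-nonZero; ≢-nonZero⁻¹; _+_; _*_; _∸_; _/_)
open import Data.Nat.Divisibility using (_∣_)
open import Data.Nat.DivMod using (_mod_)
open import Data.Nat.GCD using (gcd)
open import Data.Nat.LCM using (lcm; gcd*lcm)
open import Data.Nat.Properties using (m*n≢0; *-zeroʳ)
open import Data.Product.Base using (_×_; ∃; ∃-syntax)
open import Data.Sum.Base using (_⊎_)
open import Data.Vec.Base using (Vec; []; _∷_; _++_; lookup; map; replicate; sum; tabulate; zipWith)
open import Function.Bundles using (_⇔_)
open import Relation.Binary.PropositionalEquality using (_≡_; _≢_; cong; sym; trans)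
open import Relation.Nullary using (¬_)
open import Relation.Unary using (Pred; _∈_; _≐_)

-- ℤ/Nℤ is Fin N: the representatives 0, …, N-1 with arithmetic modulo N.

Word : ℕ → ℕ → Set
Word N n = Vec (Fin N) n

module _ {N : ℕ} .{{_ : NonZero N}} where

  infixl 6 _+ₘ_ _+ʷ_
  infixl 7 _*ₘ_ _·ʷ_

  0ₘ : Fin N
  0ₘ = 0 mod N

  _+ₘ_ : Fin N → Fin N → Fin N
  x +ₘ y = (toℕ x + toℕ y) mod N

  _*ₘ_ : Fin N → Fin N → Fin N
  x *ₘ y = (toℕ x * toℕ y) mod N

  0ʷ : ∀ {n} → Word N n
  0ʷ = replicate _ 0ₘ

  _+ʷ_ : ∀ {n} → Word N n → Word N n → Word N n
  _+ʷ_ = zipWith _+ₘ_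

  _·ʷ_ : ∀ {n} → Fin N → Word N n → Word N n
  a ·ʷ w = map (a *ₘ_) w

Code : ℕ → ℕ → Set₁
Code N n = Pred (Word N n) 0ℓ

record IsLinear {N n : ℕ} .{{_ : NonZero N}} (C : Code N n) : Set where
  field
    0-closed : 0ʷ ∈ C
    +-closed : ∀ {v w} → v ∈ C → w ∈ C → v +ʷ w ∈ C
    ·-closed : ∀ a {w} → w ∈ C → a ·ʷ w ∈ C

Matrix : ℕ → ℕ → ℕ → Set
Matrix N m n = Vec (Word N n) m

linComb : ∀ {N m n} .{{_ : NonZero N}} → Vec (Fin N) m → Matrix N m n → Word N n
linComb []       []       = 0ʷ
linComb (a ∷ as) (r ∷ rs) = a ·ʷ r +ʷ linComb as rs

rowSpan : ∀ {N m n} .{{_ : NonZero N}} → Matrix N m n → Code N n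
rowSpan M w = ∃[ as ] w ≡ linComb as M

IsGeneratingMatrix : ∀ {N m n} .{{_ : NonZero N}} → Matrix N m n → Code N n → Set
IsGeneratingMatrix M C = C ≐ rowSpan M

Extended : ∀ {N n} → Code N n → Set
Extended {N} C = ∀ w → w ∈ C → N ∣ sum (map toℕ w)

IsGCDOf : Pred ℕ 0ℓ → ℕ → Set
IsGCDOf P g = (∀ x → x ∈ P → g ∣ x) × (∀ d → (∀ x → x ∈ P → d ∣ x) → d ∣ g)

ModulusOrEntry : ∀ {N n} → Code N n → Pred ℕ 0ℓ
ModulusOrEntry {N} C x = x ≡ N ⊎ (∃[ w ] w ∈ C × ∃[ i ] x ≡ toℕ (lookup w i))

Admissible : ∀ {N n} → Code N n → Set
Admissible C = Extended C × IsGCDOf (ModulusOrEntry C) 1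

Degenerate : ∀ {N n} .{{_ : NonZero N}} → Code N n → Set
Degenerate C = ∃[ i ] ∀ w → w ∈ C → lookup w i ≡ 0ₘ

Thin : ∀ {N n} .{{_ : NonZero N}} → Code N n → Set
Thin C = Extended C × ¬ (∃[ w ] w ∈ C × ∀ i → lookup w i ≢ 0ₘ)

permute : ∀ {N n} → Permutation′ n → Word N n → Word N n
permute π w = tabulate (λ i → lookup w (π ⟨$⟩ʳ i))

infix 4 _≅_

_≅_ : ∀ {N n} → Code N n → Code N n → Set
_≅_ {n = n} C D = ∃ λ (π : Permutation′ n) → ∀ w → w ∈ C ⇔ permute π w ∈ D

instance
  lcm-nonZero : ∀ {M N} .{{_ : NonZero M}} .{{_ : NonZero N}} → NonZero (lcm M N)
  lcm-nonZero {M} {N} = ≢-nonZero λ lcm≡0 →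
    ≢-nonZero⁻¹ (M * N) {{m*n≢0 M N}}
      (trans (sym (gcd*lcm M N)) (trans (cong (gcd M N *_) lcm≡0) (*-zeroʳ (gcd M N))))

-- For M ∣ L, the map ℤ/Mℤ → ℤ/Lℤ, x ↦ (L/M)·x.
scale : ∀ {M n} L .{{_ : NonZero M}} .{{_ : NonZero L}} → Word M n → Word L n
scale {M} L = map (λ x → (L / M * toℕ x) mod L)

infixr 5 _⊕_

_⊕_ : ∀ {N₁ N₂ n₁ n₂} .{{_ : NonZero N₁}} .{{_ : NonZero N₂}} →
      Code N₁ n₁ → Code N₂ n₂ → Code (lcm N₁ N₂) (n₁ + n₂)
_⊕_ {N₁} {N₂} C₁ C₂ w =
  ∃[ c₁ ] ∃[ c₂ ] c₁ ∈ C₁ × c₂ ∈ C₂ × w ≡ scale (lcm N₁ N₂) c₁ ++ scale (lcm N₁ N₂) c₂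

data IsDirectSum : ∀ {N n} → Code N n → Set₁ where
  directSum : ∀ {N₁ N₂ n₁ n₂}
              .{{_ : NonZero N₁}} .{{_ : NonZero N₂}}
              .{{_ : NonZero n₁}} .{{_ : NonZero n₂}}
              {C : Code (lcm N₁ N₂) (n₁ + n₂)}
              {C₁ : Code N₁ n₁} {C₂ : Code N₂ n₂} →
              IsLinear C₁ → IsLinear C₂ → C ≅ C₁ ⊕ C₂ → IsDirectSum C

g : ∀ N .{{_ : NonZero N}} → Matrix N 2 5
g N = (h ∷ h ∷ o ∷ o ∷ o ∷ [])
    ∷ (h ∷ o ∷ h ∷ 1 mod N ∷ (N ∸ 1) mod N ∷ [])
    ∷ []
  where
  h o : Fin N
  h = (N / 2) mod N
  o = 0ₘ

{-# OPTIONS --safe #-}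
module Submission where

-- The columns of a generating matrix are five nonzero vectors of (ℤ/N)² with sum 0, and the code is thin iff
-- every linear form a x + b y, (a , b) ∈ ℤ², vanishes on some column, i.e. iff ℤ² is the union of the five
-- proper lattices of forms killing the columns.  Such coverings are found by a finite search: record for every
-- column the lattice of forms already known to kill it, and as long as some form lies in none of these
-- lattices, branch on the column which that form kills.  The search terminates, as the lattices only grow, and
-- it ends either with three columns (h , h), (h , 0), (0 , h) where 2h = N, or with e · v = 0 for all columns v
-- and some e ≤ 8, which forces N ∣ e by admissibility.
--
-- In the first case the other two columns are (x , y) and (- x , - y) with gcd(h , x , y) = 1.  If x and y are
-- both even, then h is odd and the code is the direct sum of zero-sum codes over ℤ/2 and ℤ/h.  Otherwise a
-- change of basis permuting the three involutions makes x even and y odd, and the code is then that of g.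

open import Defs
open import Algebra.Properties.CommutativeMonoid.Sum as Sum using ()
open import Data.Bool.Base using (true; false; if_then_else_)
open import Data.Fin.Base using (Fin; zero; suc; toℕ; _↑ˡ_; punchIn; punchOut)
open import Data.Fin.Patterns using (0F; 1F; 2F; 3F; 4F; 5F; 7F)
open import Data.Fin.Permutation as Perm using (Permutation′; _⟨$⟩ʳ_; _⟨$⟩ˡ_; _∘ₚ_; inverseʳ; transpose)
import Data.Fin.Properties as Fin
open import Data.Integer.Base using (ℤ; +_; -[1+_]; +[1+_]; +0; 0ℤ; 1ℤ; -1ℤ; _+_; _*_; _-_; -_; ∣_∣)
open import Data.Integer.DivMod using (_/_; _%ℕ_; _/ℕ_; a≡a%ℕn+[a/ℕn]*n; n%ℕd<d)
open import Data.Integer.Divisibility.Signed using (divides; ∣-trans; ∣m⇒∣-m; ∣m⇒∣m*n; ∣n⇒∣m*n; ∣m∣n⇒∣m+n; ∣m∣n⇒∣m-n; ∣m+n∣n⇒∣m; m∣∣m∣; ∣⇒∣ᵤ; ∣ᵤ⇒∣) renaming (_∣_ to _∣ᶻ_)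
import Data.Integer.Properties as ℤ
open import Data.Integer.Tactic.RingSolver using (solve-∀)
open import Data.List.Base using (List; []; _∷_; concatMap; upTo)
open import Data.List.Relation.Unary.All as All using (All; []; _∷_)
open import Data.Maybe.Base as Maybe using (Maybe; just; nothing; _<∣>_; from-just)
open import Data.Nat.Base as ℕ using (ℕ; zero; suc; s≤s; NonZero; _≤_)
import Data.Nat.DivMod as ℕ
open import Data.Nat.Divisibility as ℕ using (_∣_)
import Data.Nat.GCD as ℕ
open import Data.Nat.LCM using (lcm; gcd*lcm)
import Data.Nat.Properties as ℕ
open import Data.Product.Base using (_×_; _,_; proj₁; proj₂; ∃-syntax)
open import Data.Product.Properties using (≡-dec)
open import Data.Sum.Base using (_⊎_; inj₁; inj₂; [_,_]′)
open import Data.Vec.Base as Vec using (Vec; []; _∷_; lookup; tabulate; updateAt)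
open import Data.Vec.Properties using (lookup∘tabulate; tabulate∘lookup; tabulate-cong; lookup-zipWith; lookup-map; lookup-replicate; lookup∘updateAt; lookup∘updateAt′)
open import Function.Base using (_∘_)
open import Function.Bundles using (_⇔_; mk⇔; Equivalence)
open import Function.Construct.Composition using (_⇔-∘_)
open import Function.Construct.Symmetry using (⇔-sym)
open import Function.Definitions using (Injective)
open import Relation.Binary.Bundles using (Setoid)
open import Relation.Binary.PropositionalEquality using (_≡_; _≢_; refl; sym; trans; cong; cong₂; subst)
open import Relation.Nullary using (¬_; Dec; yes; no; does; contradiction; ¬?)
open import Relation.Nullary.Decidable using (_→-dec_; dec⇒maybe)
open import Relation.Unary using (_∈_)

open Equivalence using (to; from)
open Sum ℤ.+-0-commutativeMonoid using (sum; sum-remove; sum-permute; sum-cong-≗)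

-- Transport of divisibility and extension of injections to permutations.

∣-resp : ∀ {m a b} → a ≡ b → m ∣ᶻ a → m ∣ᶻ b
∣-resp refl m∣a = m∣a

-- Induction on `m`: once `ι zero` is punched out of the codomain, the remaining values still form
-- an injection, and `Perm.insert` puts the removed pair back.
extendToPermutation : ∀ {m k} (ι : Fin m → Fin (m ℕ.+ k)) → Injective _≡_ _≡_ ι →
                      ∃[ π ] ∀ c → π ⟨$⟩ʳ (c ↑ˡ k) ≡ ι c
extendToPermutation {zero}  ι inj = Perm.id , λ ()
extendToPermutation {suc m} {k} ι inj = Perm.insert zero (ι zero) π , agrees
  where
  ι0≢ : ∀ c → ι zero ≢ ι (suc c)
  ι0≢ c eq = Fin.0≢1+n (inj eq)
  rest = extendToPermutation {m} {k} (λ c → punchOut (ι0≢ c))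
           (λ eq → Fin.suc-injective (inj (Fin.punchOut-injective (ι0≢ _) (ι0≢ _) eq)))
  π = proj₁ rest
  agrees : ∀ c → Perm.insert zero (ι zero) π ⟨$⟩ʳ (c ↑ˡ k) ≡ ι c
  agrees zero    = refl
  agrees (suc c) = trans (cong (punchIn (ι zero)) (proj₂ rest c)) (Fin.punchIn-punchOut (ι0≢ c))

-- Integer forms and the lattices of forms killing a column.

Form Column : Set
Form   = ℤ × ℤ
Column = ℤ × ℤ

eval : Form → Column → ℤ
eval (a , b) (x , y) = a * x + b * y

-- A record rather than an abbreviation so that f can be inferred from the type.
record Kills (m : ℤ) (v : Column) (f : Form) : Set where
  constructor kills
  field m∣eval : m ∣ᶻ eval f v
open Kills public

infixl 6 _-[_]_
_-[_]_ : Form → ℤ → Form → Form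
(a , b) -[ q ] (c , d) = a - q * c , b - q * d

eval-combination : ∀ f q g v → eval (f -[ q ] g) v ≡ eval f v - q * eval g v
eval-combination (a , b) q (c , d) (x , y) = identity a b q c d x y
  where
  identity : ∀ a b q c d x y →
             (a - q * c) * x + (b - q * d) * y ≡ a * x + b * y - q * (c * x + d * y)
  identity = solve-∀

kills-combination : ∀ {m v f} q {g} → Kills m v f → Kills m v g → Kills m v (f -[ q ] g)
kills-combination {v = v} {f} q {g} (kills kf) (kills kg) =
  kills (∣-resp (sym (eval-combination f q g v)) (∣m∣n⇒∣m-n kf (∣n⇒∣m*n q kg)))

kills-combination⁻¹ : ∀ {m v} f q g → Kills m v (f -[ q ] g) → Kills m v g → Kills m v f
kills-combination⁻¹ {v = v} f q g (kills kfg) (kills kg) = kills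
  (∣-resp (trans (cong (_+ q * eval g v) (eval-combination f q g v)) (cancel (eval f v) (q * eval g v)))
          (∣m∣n⇒∣m+n kfg (∣n⇒∣m*n q kg)))
  where
  cancel : ∀ s t → s - t + t ≡ s
  cancel = solve-∀

kills-zero : ∀ {m v} → Kills m v (0ℤ , 0ℤ)
kills-zero = kills (divides 0ℤ refl)

-- Given by two generators, which suffice for any subgroup of ℤ².
Lattice : Set
Lattice = Form × Form

KillsLattice : ℤ → Column → Lattice → Set
KillsLattice m v (f , g) = Kills m v f × Kills m v g

-- No property of the quotient enters the proofs: f - q·g kills whatever f and g kill, for every q.
quot : ℤ → ℤ → ℤ
quot a +0           = 0ℤ
quot a b@(+[1+ _ ]) = a / b
quot a b@(-[1+ _ ]) = a / b

-- Euclid's algorithm on the coordinate `π`, carried out on whole forms. The number is fuel: if it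
-- runs out, the output still consists of combinations of the input, so soundness is unaffected.
euclid : (Form → ℤ) → ℕ → Form → Form → Form × Form
euclid π zero    f g = f , g
euclid π (suc k) f g =
  if does (π g ℤ.≟ 0ℤ) then (f , g) else euclid π k g (f -[ quot (π f) (π g) ] g)

kills-euclid : ∀ {m v} π k {f g} → Kills m v f → Kills m v g → KillsLattice m v (euclid π k f g)
kills-euclid π zero    kf kg = kf , kg
kills-euclid π (suc k) {f} {g} kf kg with does (π g ℤ.≟ 0ℤ)
... | true  = kf , kg
... | false = kills-euclid π k kg (kills-combination (quot (π f) (π g)) kf kg)

-- Keeps a lattice in echelon form: the second generator has vanishing first coordinate.
insert : Form → Lattice → Lattice
insert p (f , g) =
  let f′ , p′ = euclid proj₁ 8 f p in f′ , proj₁ (euclid proj₂ 8 g p′)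

-- Every generator kept is a combination of `p` and the old ones. The discarded output of the second
-- Euclid run does no harm: a smaller lattice merely records less about the column.
kills-insert : ∀ {m v p} L → Kills m v p → KillsLattice m v L → KillsLattice m v (insert p L)
kills-insert _ kp (kf , kg) =
  let kf′ , kp′ = kills-euclid proj₁ 8 kf kp in kf′ , proj₁ (kills-euclid proj₂ 8 kg kp′)

reduce : Lattice → Form → Form
reduce (f , g) p =
  let p′ = p -[ quot (proj₁ p) (proj₁ f) ] f in p′ -[ quot (proj₂ p′) (proj₂ g) ] g

infix 4 _∈ᴸ_ _∈ᴸ?_
-- A zero remainder exhibits `p` as a combination of the generators; only this direction is used.
_∈ᴸ_ : Form → Lattice → Set
p ∈ᴸ L = reduce L p ≡ (0ℤ , 0ℤ)

_∈ᴸ?_ : ∀ p L → Dec (p ∈ᴸ L)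
p ∈ᴸ? L = ≡-dec ℤ._≟_ ℤ._≟_ (reduce L p) (0ℤ , 0ℤ)

kills-∈ : ∀ {m v p} L → KillsLattice m v L → p ∈ᴸ L → Kills m v p
kills-∈ {m} {v} {p} (f , g) (kf , kg) p∈L =
  kills-combination⁻¹ p q f
    (kills-combination⁻¹ p′ q′ g (subst (Kills m v) (sym p∈L) kills-zero) kg) kf
  where
  q = quot (proj₁ p) (proj₁ f)
  p′ = p -[ q ] f
  q′ = quot (proj₂ p′) (proj₂ g)

-- Both forms kill a column v exactly when e · v = 0.
multiples : ℤ → List Form
multiples e = (e , 0ℤ) ∷ (0ℤ , e) ∷ []

-- The forms killing the columns (h , h), (h , 0) and (0 , h) when 2 h = 0.
leadForm : Fin 3 → Form
leadForm 0F = 1ℤ , -1ℤ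
leadForm 1F = 0ℤ , 1ℤ
leadForm 2F = 1ℤ , 0ℤ

kleinForms : Fin 3 → List Form
kleinForms c = leadForm c ∷ multiples (+ 2)

-- The finite search for a certificate.

State : Set
State = Vec Lattice 5

infix 4 _⊆_at_ _⊆_at?_
_⊆_at_ : List Form → State → Fin 5 → Set
fs ⊆ S at i = All (_∈ᴸ lookup S i) fs

_⊆_at?_ : ∀ fs S i → Dec (fs ⊆ S at i)
fs ⊆ S at? i = All.all? (_∈ᴸ? lookup S i) fs

-- A certificate for all coverings compatible with `S`. A `degenerate` leaf is contradictory, as it
-- makes a column zero. A `bounded` leaf, with exponent e + 1, may leave out one column, since the
-- zero sum supplies it. A `branch` has one subtree for each column that `p` might kill.
data Settled (S : State) : Set where
  degenerate : ∃[ i ] multiples 1ℤ ⊆ S at i → Settled S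
  klein      : (∀ c → ∃[ i ] kleinForms c ⊆ S at i) → Settled S
  bounded    : (e : Fin 8) → (∃[ j ] ∀ i → i ≢ j → multiples (+ suc (toℕ e)) ⊆ S at i) → Settled S
  branch     : ∀ p → (∀ i → Settled (updateAt S i (insert p))) → Settled S

firstUncovered : State → List Form → Maybe Form
firstUncovered S []       = nothing
firstUncovered S (p ∷ ps) =
  if does (Fin.any? λ i → p ∈ᴸ? lookup S i) then firstUncovered S ps else just p

sequenceFin : ∀ {n} {P : Fin n → Set} → (∀ i → Maybe (P i)) → Maybe (∀ i → P i)
sequenceFin {zero}  m = just λ ()
sequenceFin {suc n} m with m zero | sequenceFin (m ∘ suc)
... | just p | just ps = just λ { zero → p ; (suc i) → ps i }
... | _      | _       = nothing

-- The coefficient bound 4, like the depth 10 in start-settled, was found by running the search.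
smallForms : List Form
smallForms = concatMap (λ a → concatMap (λ b → (+ suc a , + suc b) ∷ (+ suc a , -[1+ b ]) ∷ [])
                                        (upTo 4)) (upTo 4)

settle : ℕ → ∀ S → Maybe (Settled S)
settle zero    S = nothing
settle (suc k) S =
  Maybe.map degenerate (dec⇒maybe (Fin.any? (multiples 1ℤ ⊆ S at?_)))
  <∣> explore (firstUncovered S smallForms)
  where
  bounded? : Fin 8 → Maybe (Settled S)
  bounded? e = Maybe.map (bounded e) (dec⇒maybe (Fin.any? λ j → Fin.all? λ i →
    ¬? (i Fin.≟ j) →-dec multiples (+ suc (toℕ e)) ⊆ S at? i))

  explore : Maybe Form → Maybe (Settled S)
  explore (just p) = Maybe.map (branch p) (sequenceFin λ i → settle k (updateAt S i (insert p)))
  explore nothing  =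
    Maybe.map klein (dec⇒maybe (Fin.all? λ c → Fin.any? (kleinForms c ⊆ S at?_)))
    -- The indices 5 and 7 stand for the exponents 6 and 8, which suffice for this search.
    <∣> bounded? 5F <∣> bounded? 7F

emptyLattice : Lattice
emptyLattice = (0ℤ , 0ℤ) , (0ℤ , 0ℤ)

-- Without loss of generality the lead forms kill columns 0, 1 and 2: they kill three different
-- columns, as any two of them generate all forms. This already covers every form with a zero
-- coordinate, so `smallForms` can omit those.
start : State
start = insert (leadForm 0F) emptyLattice ∷ insert (leadForm 1F) emptyLattice
      ∷ insert (leadForm 2F) emptyLattice ∷ emptyLattice ∷ emptyLattice ∷ []

abstract
  -- Checking the type runs the search: `from-just` yields a certificate only if the result is
  -- `just`. The certificate is sealed, as only its existence matters later.
  start-settled : Settled start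
  start-settled = from-just (settle 10 start)

-- Coverings and soundness of the search.

record Covering (m : ℤ) (v : Fin 5 → Column) : Set where
  field
    nonzero  : ∀ i → ¬ All (Kills m (v i)) (multiples 1ℤ)
    covered  : ∀ f → ∃[ i ] Kills m (v i) f
    -- The shape in which the zero sum of the columns enters.
    balanced : ∀ f j → (∀ i → i ≢ j → Kills m (v i) f) → Kills m (v j) f

covering-∘ : ∀ {m v} (π : Permutation′ 5) → Covering m v → Covering m (v ∘ (π ⟨$⟩ʳ_))
covering-∘ {m} {v} π cov = record
  { nonzero  = λ i → nonzero (π ⟨$⟩ʳ i)
  ; covered  = λ f → let i , k = covered f in
      π ⟨$⟩ˡ i , subst (λ j → Kills m (v j) f) (sym (inverseʳ π)) k
  ; balanced = λ f j others → balanced f (π ⟨$⟩ʳ j) λ i i≢πj →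
      subst (λ j → Kills m (v j) f) (inverseʳ π)
        (others (π ⟨$⟩ˡ i) λ eq → i≢πj (trans (sym (inverseʳ π)) (cong (π ⟨$⟩ʳ_) eq)))
  }
  where open Covering cov

KleinTriple : ℤ → (Fin 5 → Column) → Set
KleinTriple m v = ∃[ π ] ∀ c → All (Kills m (v (π ⟨$⟩ʳ (c ↑ˡ 2)))) (kleinForms c)

Bounded : ℤ → (Fin 5 → Column) → Set
Bounded m v = ∃[ e ] ∀ i → All (Kills m (v i)) (multiples (+ suc (toℕ {8} e)))

-- Any two of the three lead forms are a basis of ℤ².
leadForms-independent : ∀ {m v} c d → Kills m v (leadForm c) → Kills m v (leadForm d) →
                        c ≢ d → All (Kills m v) (multiples 1ℤ)
leadForms-independent 0F 0F p q c≢d = contradiction refl c≢d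
leadForms-independent 1F 1F p q c≢d = contradiction refl c≢d
leadForms-independent 2F 2F p q c≢d = contradiction refl c≢d
leadForms-independent 0F 1F p q _ = kills-combination -1ℤ p q ∷ q ∷ []
leadForms-independent 0F 2F p q _ = q ∷ kills-combination 1ℤ q p ∷ []
leadForms-independent 1F 2F p q _ = q ∷ p ∷ []
leadForms-independent 1F 0F p q _ = leadForms-independent 0F 1F q p λ ()
leadForms-independent 2F 0F p q _ = leadForms-independent 0F 2F q p λ ()
leadForms-independent 2F 1F p q _ = leadForms-independent 1F 2F q p λ ()

-- A column killed by two lead forms would be zero, so `ι` is injective and extends to a
-- permutation.
leads-to-front : ∀ {m v} → Covering m v → (ι : Fin 3 → Fin 5) →
                 (∀ c → Kills m (v (ι c)) (leadForm c)) →
                 ∃[ π ] ∀ c → π ⟨$⟩ʳ (c ↑ˡ 2) ≡ ι c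
leads-to-front {m} {v} cov ι lead = extendToPermutation ι injective
  where
  injective : Injective _≡_ _≡_ ι
  injective {c} {d} eq with c Fin.≟ d
  ... | yes c≡d = c≡d
  ... | no c≢d  = contradiction
    (leadForms-independent c d (lead c) (subst (λ i → Kills m (v i) (leadForm d)) (sym eq) (lead d)) c≢d)
    (Covering.nonzero cov (ι c))

-- Induction on the certificate. At a branch, the column that `p` really kills selects the subtree,
-- and `p` may be added to the lattice recorded for it.
settled-sound : ∀ {m v S} → Covering m v → (∀ i → KillsLattice m (v i) (lookup S i)) →
                Settled S → KleinTriple m v ⊎ Bounded m v
settled-sound {m} {v} {S} cov sat = sound
  where
  open Covering cov
  kills-at : ∀ {fs} i → fs ⊆ S at i → All (Kills m (v i)) fs
  kills-at i = All.map (kills-∈ (lookup S i) (sat i))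

  sound : Settled S → KleinTriple m v ⊎ Bounded m v
  sound (degenerate (i , one)) = contradiction (kills-at i one) (nonzero i)
  sound (klein triple) =
    let killed c = kills-at (proj₁ (triple c)) (proj₂ (triple c))
        π , π-ι = leads-to-front cov (proj₁ ∘ triple) (λ c → All.head (killed c))
    in  inj₁ (π , λ c → subst (λ i → All (Kills m (v i)) (kleinForms c)) (sym (π-ι c)) (killed c))
  sound (bounded e (j , others)) = inj₂ (e , killed)
    where
    killed : ∀ i → All (Kills m (v i)) (multiples (+ suc (toℕ e)))
    killed i with i Fin.≟ j
    ... | no i≢j = kills-at i (others i i≢j)
    -- The exempt column is killed because the forms kill the other four.
    ... | yes refl = balanced _ j (λ i i≢j → All.head (kills-at i (others i i≢j)))
                   ∷ balanced _ j (λ i i≢j → All.head (All.tail (kills-at i (others i i≢j)))) ∷ []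
  sound (branch p next) = settled-sound cov sat′ (next i)
    where
    i = proj₁ (covered p)
    sat′ : ∀ j → KillsLattice m (v j) (lookup (updateAt S i (insert p)) j)
    sat′ j with j Fin.≟ i
    ... | yes refl = subst (KillsLattice m (v j)) (sym (lookup∘updateAt j S))
                       (kills-insert (lookup S j) (proj₂ (covered p)) (sat j))
    ... | no j≢i = subst (KillsLattice m (v j)) (sym (lookup∘updateAt′ j i j≢i S)) (sat j)

-- Relabel the columns so that the state `start` holds, apply the certificate, and undo the
-- relabelling.
covering-classification : ∀ {m v} → Covering m v → KleinTriple m v ⊎ Bounded m v
covering-classification {m} {v} cov = relabel (settled-sound (covering-∘ π cov) sat start-settled)
  where
  open Covering cov
  front = leads-to-front cov (proj₁ ∘ covered ∘ leadForm) (proj₂ ∘ covered ∘ leadForm)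
  π = proj₁ front
  lead : ∀ c → Kills m (v (π ⟨$⟩ʳ (c ↑ˡ 2))) (leadForm c)
  lead c = subst (λ i → Kills m (v i) (leadForm c)) (sym (proj₂ front c)) (proj₂ (covered (leadForm c)))

  empty : ∀ {v} → KillsLattice m v emptyLattice
  empty = kills-zero , kills-zero

  sat : ∀ i → KillsLattice m (v (π ⟨$⟩ʳ i)) (lookup start i)
  sat 0F = kills-insert emptyLattice (lead 0F) empty
  sat 1F = kills-insert emptyLattice (lead 1F) empty
  sat 2F = kills-insert emptyLattice (lead 2F) empty
  sat 3F = empty
  sat 4F = empty

  relabel : KleinTriple m (v ∘ (π ⟨$⟩ʳ_)) ⊎ Bounded m (v ∘ (π ⟨$⟩ʳ_)) → KleinTriple m v ⊎ Bounded m v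
  relabel (inj₁ (ρ , triple)) = inj₁ (ρ ∘ₚ π , triple)
  relabel (inj₂ (e , killed)) = inj₂ (e , λ i →
    subst (λ j → All (Kills m (v j)) (multiples (+ suc (toℕ e)))) (inverseʳ π) (killed (π ⟨$⟩ˡ i)))

-- Integers modulo m and spans of two rows.

multiple-below⇒≡0 : ∀ {n k} → k ℕ.< n → n ℕ.∣ k → k ≡ 0
multiple-below⇒≡0 {k = zero}  _   _   = refl
multiple-below⇒≡0 {k = suc _} k<n n∣k = contradiction (ℕ.∣⇒≤ n∣k) (ℕ.<⇒≱ k<n)

-- Oriented so that matching the equation with `refl` replaces `a` by `b + factor * m`; the
-- congruence laws then become ring identities.
record Congruent (m a b : ℤ) : Set where
  constructor congruent
  field
    factor   : ℤ
    equation : a ≡ b + factor * m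

module Modulo (m : ℤ) where

  infix 4 _≈_
  _≈_ : ℤ → ℤ → Set
  _≈_ = Congruent m

  ≈-reflexive : ∀ {a b} → a ≡ b → a ≈ b
  ≈-reflexive {a} refl = congruent 0ℤ (identity a m)
    where
    identity : ∀ a m → a ≡ a + 0ℤ * m
    identity = solve-∀

  ≈-refl : ∀ {a} → a ≈ a
  ≈-refl = ≈-reflexive refl

  ≈-sym : ∀ {a b} → a ≈ b → b ≈ a
  ≈-sym {b = b} (congruent q refl) = congruent (- q) (identity b q m)
    where
    identity : ∀ b q m → b ≡ b + q * m + - q * m
    identity = solve-∀

  ≈-trans : ∀ {a b c} → a ≈ b → b ≈ c → a ≈ c
  ≈-trans {c = c} (congruent p refl) (congruent q refl) = congruent (q + p) (identity c p q m)
    where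
    identity : ∀ c p q m → c + q * m + p * m ≡ c + (q + p) * m
    identity = solve-∀

  +-cong : ∀ {a b c d} → a ≈ b → c ≈ d → a + c ≈ b + d
  +-cong {b = b} {d = d} (congruent p refl) (congruent q refl) =
    congruent (p + q) (identity b d p q m)
    where
    identity : ∀ b d p q m → b + p * m + (d + q * m) ≡ b + d + (p + q) * m
    identity = solve-∀

  +-congˡ : ∀ {a b} k → a ≈ b → k + a ≈ k + b
  +-congˡ k = +-cong (≈-refl {k})

  ≈0⇒+≈ : ∀ {a} k → a ≈ 0ℤ → a + k ≈ k
  ≈0⇒+≈ k a≈0 = ≈-trans (+-cong a≈0 (≈-refl {k})) (≈-reflexive (ℤ.+-identityˡ k))

  *-congˡ : ∀ {a b} k → a ≈ b → k * a ≈ k * b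
  *-congˡ {b = b} k (congruent q refl) = congruent (k * q) (identity k b q m)
    where
    identity : ∀ k b q m → k * (b + q * m) ≡ k * b + k * q * m
    identity = solve-∀

  *-congʳ : ∀ {a b} k → a ≈ b → a * k ≈ b * k
  *-congʳ {b = b} k (congruent q refl) = congruent (q * k) (identity k b q m)
    where
    identity : ∀ k b q m → (b + q * m) * k ≡ b * k + q * k * m
    identity = solve-∀

  ≈-setoid : Setoid _ _
  ≈-setoid = record
    { _≈_ = _≈_
    ; isEquivalence = record { refl = ≈-refl ; sym = ≈-sym ; trans = ≈-trans } }

  ∣⇒≈0 : ∀ {a} → m ∣ᶻ a → a ≈ 0ℤ
  ∣⇒≈0 (divides q eq) = congruent q (trans eq (sym (ℤ.+-identityˡ (q * m))))

  ≈0⇒∣ : ∀ {a} → a ≈ 0ℤ → m ∣ᶻ a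
  ≈0⇒∣ (congruent q eq) = divides q (trans eq (ℤ.+-identityˡ (q * m)))

  -- The coefficients are arbitrary integers, so that changes of basis and parity arguments need no
  -- reduction modulo m.
  Span : ∀ {n} → (Fin n → ℤ) → (Fin n → ℤ) → (Fin n → ℤ) → Set
  Span x y u = ∃[ a ] ∃[ b ] ∀ i → a * x i + b * y i ≈ u i

  span-cong : ∀ {n} {x y x′ y′ u : Fin n → ℤ} →
              (∀ i → x i ≈ x′ i) → (∀ i → y i ≈ y′ i) → Span x y u → Span x′ y′ u
  span-cong x≈x′ y≈y′ (a , b , eq) = a , b , λ i →
    ≈-trans (+-cong (*-congˡ a (≈-sym (x≈x′ i))) (*-congˡ b (≈-sym (y≈y′ i)))) (eq i)

  span-resp : ∀ {n} {x y u u′ : Fin n → ℤ} → (∀ i → u i ≈ u′ i) → Span x y u → Span x y u′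
  span-resp u≈u′ (a , b , eq) = a , b , λ i → ≈-trans (eq i) (u≈u′ i)

  span-permute : ∀ {n} {x y u : Fin n → ℤ} (π : Permutation′ n) →
                 Span x y u ⇔ Span (x ∘ (π ⟨$⟩ʳ_)) (y ∘ (π ⟨$⟩ʳ_)) (u ∘ (π ⟨$⟩ʳ_))
  span-permute {x = x} {y} {u} π = mk⇔
    (λ (a , b , eq) → a , b , eq ∘ (π ⟨$⟩ʳ_))
    (λ (a , b , eq) → a , b , λ i →
      subst (λ j → a * x j + b * y j ≈ u j) (inverseʳ π) (eq (π ⟨$⟩ˡ i)))

-- Words over ℤ/N as integer functions modulo N.

module Residues (N : ℕ) .{{_ : NonZero N}} where

  open Modulo (+ N) public
  open import Relation.Binary.Reasoning.Setoid ≈-setoid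

  residue : Fin N → ℤ
  residue = +_ ∘ toℕ

  residues : ∀ {n} → Word N n → Fin n → ℤ
  residues w = residue ∘ lookup w

  %-≈ : ∀ k → + (k ℕ.% N) ≈ + k
  %-≈ k = ≈-sym (congruent (+ (k ℕ./ N)) (trans (cong +_ (ℕ.m≡m%n+[m/n]*n k N))
    (trans (ℤ.pos-+ (k ℕ.% N) _) (cong (_+_ (+ (k ℕ.% N))) (ℤ.pos-* (k ℕ./ N) N)))))

  residue-mod : ∀ k → residue (k ℕ.mod N) ≈ + k
  residue-mod k = begin
    + toℕ (k ℕ.mod N)  ≡⟨ cong +_ (Fin.toℕ-fromℕ< (ℕ.m%n<n k N)) ⟩
    + (k ℕ.% N)        ≈⟨ %-≈ k ⟩
    + k                ∎

  class : ℤ → Fin N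
  class z = (z %ℕ N) ℕ.mod N

  residue-class : ∀ z → residue (class z) ≈ z
  residue-class z = begin
    residue (class z)  ≈⟨ residue-mod (z %ℕ N) ⟩
    + (z %ℕ N)         ≈⟨ congruent (z /ℕ N) (a≡a%ℕn+[a/ℕn]*n z N) ⟨
    z                  ∎

  -- The difference of two representatives is a multiple of N of absolute value below N.
  residue-injective : ∀ {s t} → residue s ≈ residue t → s ≡ t
  residue-injective {s} {t} (congruent q eq) =
    Fin.toℕ-injective (ℤ.+-injective (ℤ.i-j≡0⇒i≡j (residue s) (residue t)
      (ℤ.∣i∣≡0⇒i≡0 (multiple-below⇒≡0 bound (∣⇒∣ᵤ {+ N} N∣δ)))))
    where
    cancel : ∀ a b → b + a - b ≡ a
    cancel = solve-∀
    N∣δ : + N ∣ᶻ residue s - residue t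
    N∣δ = divides q (trans (cong (_- residue t) eq) (cancel (q * + N) (residue t)))
    bound : ∣ residue s - residue t ∣ ℕ.< N
    bound = ℕ.≤-<-trans (subst (λ z → ∣ z ∣ ℕ.≤ toℕ s ℕ.⊔ toℕ t) (sym (ℤ.[+m]-[+n]≡m⊖n (toℕ s) (toℕ t)))
                          (ℤ.∣m⊝n∣≤m⊔n (toℕ s) (toℕ t)))
                        (ℕ.⊔-lub (Fin.toℕ<n s) (Fin.toℕ<n t))

  ≈0⇒≡0ₘ : ∀ {s} → residue s ≈ 0ℤ → s ≡ 0ₘ
  ≈0⇒≡0ₘ s≈0 = residue-injective (≈-trans s≈0 (≈-sym (residue-mod 0)))

  ≡0ₘ⇒≈0 : ∀ {s} → s ≡ 0ₘ → residue s ≈ 0ℤ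
  ≡0ₘ⇒≈0 refl = residue-mod 0

  residues-injective : ∀ {n} {v w : Word N n} → (∀ i → residues v i ≈ residues w i) → v ≡ w
  residues-injective {v = v} {w} v≈w = trans (sym (tabulate∘lookup v))
    (trans (tabulate-cong (λ i → residue-injective (v≈w i))) (tabulate∘lookup w))

  classes : ∀ {n} → (Fin n → ℤ) → Word N n
  classes u = tabulate (class ∘ u)

  residues-classes : ∀ {n} (u : Fin n → ℤ) i → residues (classes u) i ≈ u i
  residues-classes u i = ≈-trans (≈-reflexive (cong residue (lookup∘tabulate (class ∘ u) i))) (residue-class (u i))

  residues-permute : ∀ {n} (π : Permutation′ n) w i → residues (permute π w) i ≈ residues w (π ⟨$⟩ʳ i)
  residues-permute π w i = ≈-reflexive (cong residue (lookup∘tabulate _ i))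

  residue-+ₘ : ∀ s t → residue (s +ₘ t) ≈ residue s + residue t
  residue-+ₘ s t = ≈-trans (residue-mod (toℕ s ℕ.+ toℕ t)) (≈-reflexive (ℤ.pos-+ (toℕ s) (toℕ t)))

  residue-*ₘ : ∀ s t → residue (s *ₘ t) ≈ residue s * residue t
  residue-*ₘ s t = ≈-trans (residue-mod (toℕ s ℕ.* toℕ t)) (≈-reflexive (ℤ.pos-* (toℕ s) (toℕ t)))

  residues-+ʷ : ∀ {n} (v w : Word N n) i → residues (v +ʷ w) i ≈ residues v i + residues w i
  residues-+ʷ v w i = ≈-trans (≈-reflexive (cong residue (lookup-zipWith _+ₘ_ i v w)))
                              (residue-+ₘ (lookup v i) (lookup w i))

  residues-·ʷ : ∀ {n} a (w : Word N n) i → residues (a ·ʷ w) i ≈ residue a * residues w i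
  residues-·ʷ a w i = ≈-trans (≈-reflexive (cong residue (lookup-map i (a *ₘ_) w)))
                              (residue-*ₘ a (lookup w i))

  residues-0ʷ : ∀ {n} i → residues (0ʷ {n = n}) i ≈ 0ℤ
  residues-0ʷ i = ≡0ₘ⇒≈0 (lookup-replicate i 0ₘ)

  residues-linComb : ∀ {n} a b (r s : Word N n) i →
    residues (linComb (a ∷ b ∷ []) (r ∷ s ∷ [])) i ≈ residue a * residues r i + residue b * residues s i
  residues-linComb a b r s i = begin
    residues (a ·ʷ r +ʷ (b ·ʷ s +ʷ 0ʷ)) i
      ≈⟨ residues-+ʷ (a ·ʷ r) (b ·ʷ s +ʷ 0ʷ) i ⟩
    residues (a ·ʷ r) i + residues (b ·ʷ s +ʷ 0ʷ) i
      ≈⟨ +-cong (residues-·ʷ a r i) (residues-+ʷ (b ·ʷ s) 0ʷ i) ⟩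
    residue a * residues r i + (residues (b ·ʷ s) i + residues 0ʷ i)
      ≈⟨ +-congˡ (residue a * residues r i) (+-cong (residues-·ʷ b s i) (residues-0ʷ i)) ⟩
    residue a * residues r i + (residue b * residues s i + 0ℤ)
      ≡⟨ cong (_+_ (residue a * residues r i)) (ℤ.+-identityʳ _) ⟩
    residue a * residues r i + residue b * residues s i ∎

  -- Reducing integer coefficients modulo N does not change the word.
  rowSpan⇔Span : ∀ {n} (r s : Word N n) w →
                 rowSpan (r ∷ s ∷ []) w ⇔ Span (residues r) (residues s) (residues w)
  rowSpan⇔Span r s w = mk⇔
    (λ { (a ∷ b ∷ [] , refl) → residue a , residue b , λ i → ≈-sym (residues-linComb a b r s i) })
    (λ (a , b , eq) → class a ∷ class b ∷ [] , residues-injective λ i → begin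
      residues w i
        ≈⟨ eq i ⟨
      a * residues r i + b * residues s i
        ≈⟨ +-cong (*-congʳ (residues r i) (residue-class a)) (*-congʳ (residues s i) (residue-class b)) ⟨
      residue (class a) * residues r i + residue (class b) * residues s i
        ≈⟨ residues-linComb (class a) (class b) r s i ⟨
      residues (linComb (class a ∷ class b ∷ []) (r ∷ s ∷ [])) i ∎)

-- Sums, Bézout identities and annihilators.

sum-toℕ : ∀ {N n} (w : Word N n) → + Vec.sum (Vec.map toℕ w) ≡ sum (λ i → + toℕ (lookup w i))
sum-toℕ []      = refl
sum-toℕ (x ∷ w) = trans (ℤ.pos-+ (toℕ x) _) (cong (_+_ (+ toℕ x)) (sum-toℕ w))

∣-sum : ∀ {m n} (t : Fin n → ℤ) → (∀ i → m ∣ᶻ t i) → m ∣ᶻ sum t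
∣-sum {n = zero}  t m∣t = divides 0ℤ refl
∣-sum {n = suc n} t m∣t = ∣m∣n⇒∣m+n (m∣t zero) (∣-sum (t ∘ suc) (m∣t ∘ suc))

-- The identity for the absolute values; signs are absorbed by the quotients in |i| = p i and |j| =
-- q j.
bezout : ∀ i j → ∃[ d ] ∃[ s ] ∃[ t ] s * i + t * j ≡ + d × (+ d ∣ᶻ i) × (+ d ∣ᶻ j)
bezout i j with ℕ.Bézout.lemma ∣ i ∣ ∣ j ∣ | m∣∣m∣ {i} | m∣∣m∣ {j}
... | ℕ.Bézout.result d g b | divides p ∣i∣≡ | divides q ∣j∣≡ =
  d , proj₁ (signed b) , proj₁ (proj₂ (signed b)) , proj₂ (proj₂ (signed b)) ,
  ∣ᵤ⇒∣ (ℕ.GCD.gcd∣m g) , ∣ᵤ⇒∣ (ℕ.GCD.gcd∣n g)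
  where
  isolate : ∀ d u v → d ≡ d + v * u - v * u
  isolate = solve-∀
  identity⁺ : ∀ a b p q i j → a * (p * i) - b * (q * j) ≡ a * p * i + - b * q * j
  identity⁺ = solve-∀
  identity⁻ : ∀ a b p q i j → b * (q * j) - a * (p * i) ≡ - a * p * i + b * q * j
  identity⁻ = solve-∀
  lift : ∀ {k l k′ l′} → d ℕ.+ l ℕ.* l′ ≡ k ℕ.* k′ → + d ≡ + k * + k′ - + l * + l′
  lift {k} {l} {k′} {l′} eq = trans (isolate (+ d) (+ l′) (+ l)) (cong (_- + l * + l′)
    (trans (cong (_+_ (+ d)) (sym (ℤ.pos-* l l′))) (trans (sym (ℤ.pos-+ d _)) (trans (cong +_ eq) (ℤ.pos-* k k′)))))
  signed : ℕ.Bézout.Identity d ∣ i ∣ ∣ j ∣ → ∃[ s ] ∃[ t ] s * i + t * j ≡ + d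
  signed (ℕ.Bézout.+- a b eq) = + a * p , - + b * q , sym (trans (lift {a} {b} eq)
    (trans (cong₂ (λ k l → + a * k - + b * l) ∣i∣≡ ∣j∣≡) (identity⁺ (+ a) (+ b) p q i j)))
  signed (ℕ.Bézout.-+ a b eq) = - + a * p , + b * q , sym (trans (lift {b} {a} eq)
    (trans (cong₂ (λ k l → + b * l - + a * k) ∣i∣≡ ∣j∣≡) (identity⁻ (+ a) (+ b) p q i j)))

-- Let d = gcd(n, e) = s n + t e. Then n divides k d for all k in `P`, so n / d divides all of `P`
-- and equals 1. Hence n = d divides e.
annihilator : ∀ {P n e} .{{_ : NonZero n}} → IsGCDOf P 1 →
              (∀ k → k ∈ P → n ℕ.∣ e ℕ.* k) → n ℕ.∣ e
annihilator {P} {n} {e} (_ , greatest) n∣ek with bezout (+ n) (+ e)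
... | d , s , t , eq , d∣n , d∣e with ∣⇒∣ᵤ d∣n
... | ℕ.divides q n≡qd = subst (ℕ._∣ e) d≡n (∣⇒∣ᵤ d∣e)
  where
  d≢0 : NonZero d
  d≢0 = ℕ.≢-nonZero λ d≡0 → ℕ.≢-nonZero⁻¹ n (trans n≡qd (trans (cong (q ℕ.*_) d≡0) (ℕ.*-zeroʳ q)))

  n∣kd : ∀ k → k ∈ P → n ℕ.∣ k ℕ.* d
  n∣kd k k∈P = subst (n ℕ.∣_) (ℤ.abs-* (+ k) (+ d)) (∣⇒∣ᵤ {+ n} (subst (+ n ∣ᶻ_) expand
    (∣m∣n⇒∣m+n (∣n⇒∣m*n (+ k * s) (∣ᵤ⇒∣ {+ n} ℕ.∣-refl)) (∣n⇒∣m*n t (∣ᵤ⇒∣ {+ n} {+ (e ℕ.* k)} (n∣ek k k∈P))))))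
    where
    identity : ∀ k s n t e → k * s * n + t * (e * k) ≡ k * (s * n + t * e)
    identity = solve-∀
    expand : + k * s * + n + t * + (e ℕ.* k) ≡ + k * + d
    expand = trans (cong (λ z → + k * s * + n + t * z) (ℤ.pos-* e k))
      (trans (identity (+ k) s (+ n) t (+ e)) (cong (_*_ (+ k)) eq))

  q∣ : ∀ k → k ∈ P → q ℕ.∣ k
  q∣ k k∈P = ℕ.*-cancelʳ-∣ d {{d≢0}} (subst (ℕ._∣ k ℕ.* d) n≡qd (n∣kd k k∈P))

  d≡n : d ≡ n
  d≡n = sym (trans n≡qd (trans (cong (ℕ._* d) (ℕ.∣1⇒≡1 (greatest q q∣))) (ℕ.*-identityˡ d)))

-- From thin codes to coverings.

eval-coordinate₁ : ∀ e x y → e * x + 0ℤ * y ≡ e * x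
eval-coordinate₁ = solve-∀

eval-coordinate₂ : ∀ e x y → 0ℤ * x + e * y ≡ e * y
eval-coordinate₂ = solve-∀

module _ {N : ℕ} .{{_ : NonZero N}} {C : Code N 5} {x y : Fin 5 → ℤ} where

  open Residues N
  open import Relation.Binary.Reasoning.Setoid ≈-setoid

  column : Fin 5 → Column
  column i = x i , y i

  kills-multiples : ∀ {e i} → All (Kills (+ N) (column i)) (multiples e) → e * x i ≈ 0ℤ × e * y i ≈ 0ℤ
  kills-multiples {e} {i} (kills kx ∷ kills ky ∷ []) =
    ∣⇒≈0 (∣-resp (eval-coordinate₁ e (x i) (y i)) kx) , ∣⇒≈0 (∣-resp (eval-coordinate₂ e (x i) (y i)) ky)

  module _ (span : ∀ w → w ∈ C ⇔ Span x y (residues w)) where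

    killed-entry : ∀ e i {w} → All (Kills (+ N) (column i)) (multiples e) → w ∈ C → e * residues w i ≈ 0ℤ
    killed-entry e i {w} killed w∈C with kills-multiples {e} {i} killed | to (span w) w∈C
    ... | ex≈0 , ey≈0 | a , b , eq = begin
      e * residues w i               ≈⟨ *-congˡ e (eq i) ⟨
      e * (a * x i + b * y i)        ≡⟨ identity e a b (x i) (y i) ⟩
      a * (e * x i) + b * (e * y i)  ≈⟨ +-cong (*-congˡ a ex≈0) (*-congˡ b ey≈0) ⟩
      a * 0ℤ + b * 0ℤ                ≡⟨ vanish a b ⟩
      0ℤ                             ∎
      where
      identity : ∀ e a b x y → e * (a * x + b * y) ≡ a * (e * x) + b * (e * y)
      identity = solve-∀
      vanish : ∀ a b → a * 0ℤ + b * 0ℤ ≡ 0ℤ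
      vanish = solve-∀

    -- An exponent killing all columns annihilates every entry of every word, so admissibility makes
    -- N divide it.
    bounded⇒N≤8 : Admissible C → Bounded (+ N) column → N ℕ.≤ 8
    bounded⇒N≤8 (_ , isGCD) (e , killed) = ℕ.≤-trans (ℕ.∣⇒≤ N∣e) (Fin.toℕ<n e)
      where
      N∣e*entry : ∀ k → k ∈ ModulusOrEntry C → N ℕ.∣ suc (toℕ e) ℕ.* k
      N∣e*entry k (inj₁ refl) = ℕ.n∣m*n (suc (toℕ e))
      N∣e*entry k (inj₂ (w , w∈C , i , refl)) = subst (N ℕ.∣_) (ℤ.abs-* (+ suc (toℕ e)) (residues w i))
        (∣⇒∣ᵤ {+ N} (≈0⇒∣ (killed-entry (+ suc (toℕ e)) i (killed i) w∈C)))
      N∣e : N ℕ.∣ suc (toℕ e)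
      N∣e = annihilator isGCD N∣e*entry

    private
      word : Form → Word N 5
      word f = classes (λ i → eval f (column i))

      residues-word : ∀ f i → residues (word f) i ≈ eval f (column i)
      residues-word f = residues-classes (λ i → eval f (column i))

      word∈C : ∀ f → word f ∈ C
      word∈C (a , b) = from (span _) (a , b , λ i → ≈-sym (residues-word (a , b) i))

    extended⇒sum≈0 : Extended C → ∀ f → sum (λ i → eval f (column i)) ≈ 0ℤ
    extended⇒sum≈0 ext f = begin
      sum (λ i → eval f (column i))  ≈⟨ sum-≈ (residues-word f) ⟨
      sum (residues (word f))        ≡⟨ sum-toℕ (word f) ⟨
      + Vec.sum (Vec.map toℕ (word f))  ≈⟨ ∣⇒≈0 (∣ᵤ⇒∣ (ext (word f) (word∈C f))) ⟩
      0ℤ ∎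
      where
      sum-≈ : ∀ {n} {s t : Fin n → ℤ} → (∀ i → s i ≈ t i) → sum s ≈ sum t
      sum-≈ {zero}  eq = ≈-refl
      sum-≈ {suc n} eq = +-cong (eq zero) (sum-≈ (eq ∘ suc))

    -- A form is a coefficient vector, and it kills column i exactly when the word it gives vanishes
    -- at i. So thinness is covering, non-degeneracy says that no column is zero, and extendedness
    -- gives balance.
    thin⇒covering : ¬ Degenerate C → Thin C → Covering (+ N) column
    thin⇒covering nondeg (ext , thin) = record
      { nonzero  = λ i killed → nondeg (i , λ w w∈C →
          ≈0⇒≡0ₘ (≈-trans (≈-reflexive (sym (ℤ.*-identityˡ _))) (killed-entry 1ℤ i killed w∈C)))
      ; covered  = covered
      ; balanced = λ f j others → kills (∣m+n∣n⇒∣m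
          (∣-resp (sum-remove (λ i → eval f (column i))) (≈0⇒∣ (extended⇒sum≈0 ext f)))
          (∣-sum _ λ k → m∣eval (others (punchIn j k) (Fin.punchInᵢ≢i j k))))
      }
      where
      covered : ∀ f → ∃[ i ] Kills (+ N) (column i) f
      -- Thinness is a negative statement; the vanishing coordinate itself is found by testing all
      -- five.
      covered f with Fin.any? (λ i → lookup (word f) i Fin.≟ 0ₘ)
      ... | yes (i , eq) = i , kills (≈0⇒∣ (≈-trans (≈-sym (residues-word f i)) (≡0ₘ⇒≈0 eq)))
      ... | no none = contradiction (word f , word∈C f , λ i eq → none (i , eq)) thin

-- Codes with three involutions among their columns.

parity : ∀ z → (∃[ k ] z ≡ k * + 2) ⊎ (∃[ k ] z ≡ 1ℤ + k * + 2)
parity z with z %ℕ 2 | a≡a%ℕn+[a/ℕn]*n z 2 | n%ℕd<d z 2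
... | 0 | eq | _ = inj₁ (z /ℕ 2 , trans eq (ℤ.+-identityˡ _))
... | 1 | eq | _ = inj₂ (z /ℕ 2 , eq)
... | suc (suc _) | _ | s≤s (s≤s ())

-- The columns are (h , h), (h , 0), (0 , h), (x , y), (- x , - y). For 2h = N, x = 0 and y = 1
-- these are the rows of `g`.
rowX rowY : ℤ → ℤ → Fin 5 → ℤ
rowX h x = lookup (h ∷ h ∷ 0ℤ ∷ x ∷ - x ∷ [])
rowY h y = lookup (h ∷ 0ℤ ∷ h ∷ y ∷ - y ∷ [])

module _ {N : ℕ} .{{_ : NonZero N}} where

  open Residues N
  open import Relation.Binary.Reasoning.Setoid ≈-setoid

  record KleinForm (C : Code N 5) (h x y : ℤ) : Set where
    constructor kleinForm
    field
      π    : Permutation′ 5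
      span : ∀ w → w ∈ C ⇔ Span (rowX h x) (rowY h y) (residues w ∘ (π ⟨$⟩ʳ_))

  -- Write 2z = qN. An even q would give z ≡ 0, so q = 1 + 2k and N = 2 (z - kN).
  involution : ∀ {z} → + 2 * z ≈ 0ℤ → ¬ (z ≈ 0ℤ) → ∃[ h ] + N ≡ h * + 2 × z ≈ h
  involution {z} (congruent q eq) z≉0 with parity q
  ... | inj₁ (k , refl) = contradiction (congruent k (ℤ.*-cancelˡ-≡ (+ 2) z _ (trans eq (identity k (+ N))))) z≉0
    where
    identity : ∀ k n → 0ℤ + k * + 2 * n ≡ + 2 * (0ℤ + k * n)
    identity = solve-∀
  ... | inj₂ (k , refl) = z - k * + N , even , congruent k (cancel z (k * + N))
    where
    cancel : ∀ z t → z ≡ z - t + t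
    cancel = solve-∀
    identity : ∀ k n → n ≡ 0ℤ + (1ℤ + k * + 2) * n - + 2 * (k * n)
    identity = solve-∀
    factor2 : ∀ z t → + 2 * z - + 2 * t ≡ (z - t) * + 2
    factor2 = solve-∀
    even : + N ≡ (z - k * + N) * + 2
    even = trans (identity k (+ N)) (trans (cong (_- + 2 * (k * + N)) (sym eq)) (factor2 z (k * + N)))

  last≈negated : ∀ {a b c p q} → sum (lookup (a ∷ b ∷ c ∷ p ∷ q ∷ [])) ≈ 0ℤ → a + (b + c) ≈ 0ℤ → q ≈ - p
  last≈negated {a} {b} {c} {p} {q} total≈0 abc≈0 = begin
    q                                             ≡⟨ identity a b c p q ⟩
    a + (b + (c + (p + (q + 0ℤ)))) + (-1ℤ * (a + (b + c)) + - p)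
      ≈⟨ +-cong total≈0 (+-cong (*-congˡ -1ℤ abc≈0) (≈-refl { - p})) ⟩
    0ℤ + (-1ℤ * 0ℤ + - p)                         ≡⟨ simplify p ⟩
    - p                                           ∎
    where
    identity : ∀ a b c p q → q ≡ a + (b + (c + (p + (q + 0ℤ)))) + (-1ℤ * (a + (b + c)) + - p)
    identity = solve-∀
    simplify : ∀ p → 0ℤ + (-1ℤ * 0ℤ + - p) ≡ - p
    simplify = solve-∀

  module _ {C : Code N 5} {x y : Fin 5 → ℤ} (span : ∀ w → w ∈ C ⇔ Span x y (residues w)) where

    private
      v : Fin 5 → Column
      v i = x i , y i

    -- In each column of the triple, the lead form and the factor 2 leave only one nonzero value.
    -- These three columns sum to zero, so the other two are opposite.
    kleinTriple⇒kleinForm : Extended C → Covering (+ N) v → KleinTriple (+ N) v →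
      ∃[ h ] ∃[ p ] ∃[ q ] + N ≡ h * + 2 × KleinForm C h p q
    kleinTriple⇒kleinForm ext cov (π , triple) = h , x′ 3F , y′ 3F , N≡2h , kleinForm π λ w → mk⇔
        (span-cong x≈ y≈ ∘ to (span-permute π) ∘ to (span w))
        (from (span w) ∘ from (span-permute π) ∘ span-cong (≈-sym ∘ x≈) (≈-sym ∘ y≈))
      where
      x′ y′ : Fin 5 → ℤ
      x′ i = x (π ⟨$⟩ʳ i)
      y′ i = y (π ⟨$⟩ʳ i)

      identity₁ : ∀ x y → 1ℤ * x + 0ℤ * y ≡ x
      identity₁ = solve-∀
      identity₂ : ∀ x y → 0ℤ * x + 1ℤ * y ≡ y
      identity₂ = solve-∀

      nonzero : ∀ i → x′ i ≈ 0ℤ → y′ i ≈ 0ℤ → ∀ {A : Set} → A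
      nonzero i x≈0 y≈0 = contradiction
        ( kills (∣-resp (sym (identity₁ (x′ i) (y′ i))) (≈0⇒∣ x≈0))
        ∷ kills (∣-resp (sym (identity₂ (x′ i) (y′ i))) (≈0⇒∣ y≈0)) ∷ [])
        (Covering.nonzero cov (π ⟨$⟩ʳ i))

      doubled : ∀ c → + 2 * x′ (c ↑ˡ 2) ≈ 0ℤ × + 2 * y′ (c ↑ˡ 2) ≈ 0ℤ
      doubled c = kills-multiples {C = C} {x = x} {y} (All.tail (triple c))

      lead : ∀ c → eval (leadForm c) (x′ (c ↑ˡ 2) , y′ (c ↑ˡ 2)) ≈ 0ℤ
      lead c = ∣⇒≈0 (m∣eval (All.head (triple c)))

      x0≈y0 : x′ 0F ≈ y′ 0F
      x0≈y0 = begin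
        x′ 0F                                  ≡⟨ identity (x′ 0F) (y′ 0F) ⟩
        y′ 0F + (1ℤ * x′ 0F + -1ℤ * y′ 0F)     ≈⟨ +-congˡ (y′ 0F) (lead 0F) ⟩
        y′ 0F + 0ℤ                             ≡⟨ ℤ.+-identityʳ _ ⟩
        y′ 0F                                  ∎
        where
        identity : ∀ x y → x ≡ y + (1ℤ * x + -1ℤ * y)
        identity = solve-∀

      y1≈0 : y′ 1F ≈ 0ℤ
      y1≈0 = ≈-trans (≈-reflexive (sym (identity₂ (x′ 1F) (y′ 1F)))) (lead 1F)

      x2≈0 : x′ 2F ≈ 0ℤ
      x2≈0 = ≈-trans (≈-reflexive (sym (identity₁ (x′ 2F) (y′ 2F)))) (lead 2F)

      half = involution (proj₁ (doubled 0F)) λ x0≈0 → nonzero 0F x0≈0 (≈-trans (≈-sym x0≈y0) x0≈0)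
      h = proj₁ half
      N≡2h : + N ≡ h * + 2
      N≡2h = proj₁ (proj₂ half)
      x0≈h : x′ 0F ≈ h
      x0≈h = proj₂ (proj₂ half)

      -- Cancelling 2 in N = 2h′ = 2h shows that every involution is the same `h`.
      ≈h : ∀ {z} → + 2 * z ≈ 0ℤ → ¬ (z ≈ 0ℤ) → z ≈ h
      ≈h {z} 2z≈0 z≉0 with involution 2z≈0 z≉0
      ... | h′ , N≡2h′ , z≈h′ = subst (z ≈_) (ℤ.*-cancelʳ-≡ h′ h (+ 2) (trans (sym N≡2h′) N≡2h)) z≈h′

      y0≈h : y′ 0F ≈ h
      y0≈h = ≈-trans (≈-sym x0≈y0) x0≈h
      x1≈h : x′ 1F ≈ h
      x1≈h = ≈h (proj₁ (doubled 1F)) λ x1≈0 → nonzero 1F x1≈0 y1≈0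
      y2≈h : y′ 2F ≈ h
      y2≈h = ≈h (proj₂ (doubled 2F)) λ y2≈0 → nonzero 2F x2≈0 y2≈0

      2h≈0 : h + (h + 0ℤ) ≈ 0ℤ
      2h≈0 = congruent 1ℤ (trans (identity h) (cong (λ n → 0ℤ + 1ℤ * n) (sym N≡2h)))
        where
        identity : ∀ h → h + (h + 0ℤ) ≡ 0ℤ + 1ℤ * (h * + 2)
        identity = solve-∀

      sum′≈0 : ∀ f (t : Fin 5 → ℤ) → (∀ i → eval f (v i) ≡ t i) → sum (t ∘ (π ⟨$⟩ʳ_)) ≈ 0ℤ
      sum′≈0 f t eq = begin
        sum (t ∘ (π ⟨$⟩ʳ_))          ≡⟨ sum-permute t π ⟨
        sum t                        ≡⟨ sum-cong-≗ eq ⟨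
        sum (λ i → eval f (v i))     ≈⟨ extended⇒sum≈0 {C = C} {x = x} {y} span ext f ⟩
        0ℤ                           ∎

      x4≈-x3 : x′ 4F ≈ - x′ 3F
      x4≈-x3 = last≈negated {x′ 0F} {x′ 1F} {x′ 2F} (sum′≈0 (1ℤ , 0ℤ) x (λ i → identity₁ (x i) (y i)))
        (≈-trans (+-cong x0≈h (+-cong x1≈h x2≈0)) 2h≈0)

      y4≈-y3 : y′ 4F ≈ - y′ 3F
      y4≈-y3 = last≈negated {y′ 0F} {y′ 1F} {y′ 2F} (sum′≈0 (0ℤ , 1ℤ) y (λ i → identity₂ (x i) (y i)))
        (≈-trans (+-cong y0≈h (+-cong y1≈0 y2≈h)) (≈-trans (≈-reflexive (cong (_+_ h) (ℤ.+-comm 0ℤ h))) 2h≈0))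

      x≈ : ∀ i → x′ i ≈ rowX h (x′ 3F) i
      x≈ 0F = x0≈h
      x≈ 1F = x1≈h
      x≈ 2F = x2≈0
      x≈ 3F = ≈-refl
      x≈ 4F = x4≈-x3

      y≈ : ∀ i → y′ i ≈ rowY h (y′ 3F) i
      y≈ 0F = y0≈h
      y≈ 1F = y1≈0
      y≈ 2F = y2≈h
      y≈ 3F = ≈-refl
      y≈ 4F = y4≈-y3

  -- The gcd e of h, x and y divides both rows and N = 2h, hence every entry of every word;
  -- admissibility gives e = 1.
  bezout-kleinForm : ∀ {C h x y} → + N ≡ h * + 2 → KleinForm C h x y → Admissible C →
                     ∃[ α ] ∃[ β ] ∃[ γ ] α * h + β * x + γ * y ≡ 1ℤ
  bezout-kleinForm {C} {h} {x} {y} N≡2h (kleinForm π span) (_ , _ , greatest)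
    with bezout h x
  ... | d , α , β , eq , d∣h , d∣x with bezout (+ d) y
  ... | e , s , t , eq′ , e∣d , e∣y = s * α , s * β , t , trans (identity s t α β h x y) (trans
        (cong (λ z → s * z + t * y) eq) (trans eq′ (cong +_ (ℕ.∣1⇒≡1 (greatest e e∣entry)))))
    where
    identity : ∀ s t α β h x y → s * α * h + s * β * x + t * y ≡ s * (α * h + β * x) + t * y
    identity = solve-∀
    e∣h : + e ∣ᶻ h
    e∣h = ∣-trans e∣d d∣h
    e∣x : + e ∣ᶻ x
    e∣x = ∣-trans e∣d d∣x
    e∣N : + e ∣ᶻ + N
    e∣N = subst (+ e ∣ᶻ_) (sym N≡2h) (∣m⇒∣m*n (+ 2) e∣h)
    e∣0 : + e ∣ᶻ 0ℤ
    e∣0 = divides 0ℤ refl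
    e∣rowX : ∀ i → + e ∣ᶻ rowX h x i
    e∣rowX 0F = e∣h
    e∣rowX 1F = e∣h
    e∣rowX 2F = e∣0
    e∣rowX 3F = e∣x
    e∣rowX 4F = ∣m⇒∣-m e∣x
    e∣rowY : ∀ i → + e ∣ᶻ rowY h y i
    e∣rowY 0F = e∣h
    e∣rowY 1F = e∣0
    e∣rowY 2F = e∣h
    e∣rowY 3F = e∣y
    e∣rowY 4F = ∣m⇒∣-m e∣y
    e∣residue : ∀ {w} → w ∈ C → ∀ i → + e ∣ᶻ residues w (π ⟨$⟩ʳ i)
    e∣residue {w} w∈C i with to (span w) w∈C
    ... | a , b , spanned with ≈-sym (spanned i)
    ... | congruent q eq = subst (+ e ∣ᶻ_) (sym eq)
      (∣m∣n⇒∣m+n (∣m∣n⇒∣m+n (∣n⇒∣m*n a (e∣rowX i)) (∣n⇒∣m*n b (e∣rowY i))) (∣n⇒∣m*n q e∣N))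
    e∣entry : ∀ k → k ∈ ModulusOrEntry C → e ℕ.∣ k
    e∣entry k (inj₁ refl) = ∣⇒∣ᵤ e∣N
    e∣entry k (inj₂ (w , w∈C , i , refl)) =
      ∣⇒∣ᵤ (subst (λ j → + e ∣ᶻ residues w j) (inverseʳ π) (e∣residue w∈C (π ⟨$⟩ˡ i)))

-- Changes of basis and the normal form.

module _ {m : ℤ} where

  open Modulo m

  span-swap : ∀ {n} {x y u : Fin n → ℤ} → Span x y u → Span y x u
  span-swap {x = x} {y} (a , b , eq) = b , a , λ i → ≈-trans (≈-reflexive (ℤ.+-comm (b * y i) (a * x i))) (eq i)

  span-shear : ∀ {n} {x y u : Fin n → ℤ} k → Span x y u → Span (λ i → x i + k * y i) y u
  span-shear {x = x} {y} k (a , b , eq) = a , b - k * a , λ i →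
    ≈-trans (≈-reflexive (identity a b k (x i) (y i))) (eq i)
    where
    identity : ∀ a b k x y → a * (x + k * y) + (b - k * a) * y ≡ a * x + b * y
    identity = solve-∀

module _ {N : ℕ} .{{_ : NonZero N}} where

  open Residues N
  open import Relation.Binary.Reasoning.Setoid ≈-setoid

  module _ {C : Code N 5} {h : ℤ} where

    -- For a change of basis that permutes the three involutions: `σ` puts them back in their
    -- standard places.
    kleinForm-rebase : ∀ {x y x′ y′} (σ : Permutation′ 5) {p q : Fin 5 → ℤ} →
      (∀ u → Span (rowX h x) (rowY h y) u ⇔ Span p q u) →
      (∀ i → p (σ ⟨$⟩ʳ i) ≈ rowX h x′ i) → (∀ i → q (σ ⟨$⟩ʳ i) ≈ rowY h y′ i) →
      KleinForm C h x y → KleinForm C h x′ y′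
    kleinForm-rebase σ rebase p≈ q≈ (kleinForm π span) = kleinForm (σ ∘ₚ π) λ w → mk⇔
      (span-cong p≈ q≈ ∘ to (span-permute σ) ∘ to (rebase _) ∘ to (span w))
      (from (span w) ∘ from (rebase _) ∘ from (span-permute σ) ∘ span-cong (≈-sym ∘ p≈) (≈-sym ∘ q≈))

    -- Exchanging the rows exchanges the columns (h , 0) and (0 , h).
    kleinForm-swap : ∀ {x y} → KleinForm C h x y → KleinForm C h y x
    kleinForm-swap {x} {y} = kleinForm-rebase (transpose 1F 2F)
      (λ u → mk⇔ (span-swap {x = rowX h x} {rowY h y}) (span-swap {x = rowY h y} {rowX h x}))
      (λ { 0F → ≈-refl ; 1F → ≈-refl ; 2F → ≈-refl ; 3F → ≈-refl ; 4F → ≈-refl })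
      (λ { 0F → ≈-refl ; 1F → ≈-refl ; 2F → ≈-refl ; 3F → ≈-refl ; 4F → ≈-refl })

    module _ (N≡2h : + N ≡ h * + 2) where

      even*h≈0 : ∀ k → k * + 2 * h ≈ 0ℤ
      even*h≈0 k = congruent k (trans (identity k h) (cong (λ n → 0ℤ + k * n) (sym N≡2h)))
        where
        identity : ∀ k h → k * + 2 * h ≡ 0ℤ + k * (h * + 2)
        identity = solve-∀

      same-parity : ∀ {a} s k → a ≡ s + k * + 2 → a * h ≈ s * h
      same-parity s k refl = begin
        (s + k * + 2) * h      ≡⟨ ℤ.*-distribʳ-+ h s (k * + 2) ⟩
        s * h + k * + 2 * h    ≈⟨ +-congˡ (s * h) (even*h≈0 k) ⟩
        s * h + 0ℤ             ≡⟨ ℤ.+-identityʳ (s * h) ⟩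
        s * h                  ∎

      -- Adding the second row to the first exchanges (h , h) and (0 , h), because 2h ≡ 0, and fixes
      -- (h , 0).
      kleinForm-add : ∀ {x y} → KleinForm C h x y → KleinForm C h (x + y) y
      kleinForm-add {x} {y} = kleinForm-rebase (transpose 0F 2F)
        (λ u → mk⇔ (span-shear {x = rowX h x} {rowY h y} 1ℤ) (unshear u)) p≈
        (λ { 0F → ≈-refl ; 1F → ≈-refl ; 2F → ≈-refl ; 3F → ≈-refl ; 4F → ≈-refl })
        where
        p : Fin 5 → ℤ
        p i = rowX h x i + 1ℤ * rowY h y i
        cancel : ∀ x y → x + 1ℤ * y + -1ℤ * y ≡ x
        cancel = solve-∀
        unshear : ∀ u → Span p (rowY h y) u → Span (rowX h x) (rowY h y) u
        unshear u s = span-cong (λ i → ≈-reflexive (cancel (rowX h x i) (rowY h y i))) (λ _ → ≈-refl)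
          (span-shear {x = p} {rowY h y} -1ℤ s)
        identity₀ : ∀ h → 0ℤ + 1ℤ * h ≡ h
        identity₀ = solve-∀
        identity₁ : ∀ h → h + 1ℤ * 0ℤ ≡ h
        identity₁ = solve-∀
        identity₂ : ∀ h → h + 1ℤ * h ≡ 1ℤ * + 2 * h
        identity₂ = solve-∀
        identity₃ : ∀ x y → x + 1ℤ * y ≡ x + y
        identity₃ = solve-∀
        identity₄ : ∀ x y → - x + 1ℤ * - y ≡ - (x + y)
        identity₄ = solve-∀
        p≈ : ∀ i → p (transpose 0F 2F ⟨$⟩ʳ i) ≈ rowX h (x + y) i
        p≈ 0F = ≈-reflexive (identity₀ h)
        p≈ 1F = ≈-reflexive (identity₁ h)
        p≈ 2F = ≈-trans (≈-reflexive (identity₂ h)) (even*h≈0 1ℤ)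
        p≈ 3F = ≈-reflexive (identity₃ x y)
        p≈ 4F = ≈-reflexive (identity₄ x y)

      -- The first three columns see the coefficients only through their products with h, the last
      -- two only through a x + b y.
      agree : ∀ a b s t {x y} → a * h ≈ s * h → b * h ≈ t * h → a * x + b * y ≈ t →
              ∀ i → a * rowX h x i + b * rowY h y i ≈ s * rowX h 0ℤ i + t * rowY h 1ℤ i
      agree _ _ _ _ ah bh t≈ 0F = +-cong ah bh
      agree a b s t ah bh t≈ 1F = +-cong ah (≈-reflexive (trans (ℤ.*-zeroʳ b) (sym (ℤ.*-zeroʳ t))))
      agree a b s t ah bh t≈ 2F = +-cong (≈-reflexive (trans (ℤ.*-zeroʳ a) (sym (ℤ.*-zeroʳ s)))) bh
      agree _ _ s t ah bh t≈ 3F = ≈-trans t≈ (≈-reflexive (identity s t))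
        where
        identity : ∀ s t → t ≡ s * 0ℤ + t * 1ℤ
        identity = solve-∀
      agree a b s t {x} {y} ah bh t≈ 4F = begin
        a * - x + b * - y        ≡⟨ identity a b x y ⟩
        -1ℤ * (a * x + b * y)    ≈⟨ *-congˡ -1ℤ t≈ ⟩
        -1ℤ * t                  ≡⟨ identity′ s t ⟩
        s * 0ℤ + t * -1ℤ         ∎
        where
        identity : ∀ a b x y → a * - x + b * - y ≡ -1ℤ * (a * x + b * y)
        identity = solve-∀
        identity′ : ∀ s t → -1ℤ * t ≡ s * 0ℤ + t * -1ℤ
        identity′ = solve-∀

      -- With x even and y odd, a x + b y has the parity of b, so (a , b) becomes (a , a x + b y).
      -- The way back rests on y - 2l (β x + γ y) = 1 + 2l α h ≡ 1, by the Bézout relation and 2h =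
      -- N.
      kleinForm-normalise : ∀ {x y} k l → x ≡ k * + 2 → y ≡ 1ℤ + l * + 2 →
        ∃[ α ] ∃[ β ] ∃[ γ ] α * h + β * x + γ * y ≡ 1ℤ →
        KleinForm C h x y → KleinForm C h 0ℤ 1ℤ
      kleinForm-normalise k l refl refl (α , β , γ , bez) (kleinForm π span) = kleinForm π λ w → mk⇔
        (λ w∈C → let a , b , eq = to (span w) w∈C in
          a , a * x + b * y , λ i → ≈-trans (≈-sym (agree a b a (a * x + b * y) ≈-refl (t-parity a b) ≈-refl i)) (eq i))
        (λ (s , t , eq) → from (span w) (coeff₁ s t , coeff₂ s t , λ i →
          ≈-trans (agree (coeff₁ s t) (coeff₂ s t) s t (a-parity s t) (b-parity s t) (t-value s t) i) (eq i)))
        where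
        x = k * + 2
        y = 1ℤ + l * + 2
        t-parity : ∀ a b → b * h ≈ (a * x + b * y) * h
        t-parity a b = ≈-sym (same-parity b (a * k + b * l) (identity a b k l))
          where
          identity : ∀ a b k l → a * (k * + 2) + b * (1ℤ + l * + 2) ≡ b + (a * k + b * l) * + 2
          identity = solve-∀

        -- p x + q y ≡ 1 modulo N; adding a multiple of (y , - x) then adjusts the parity of the first coefficient.
        p = - (l * + 2 * β)
        q = 1ℤ - l * + 2 * γ
        coeff₁ coeff₂ : ℤ → ℤ → ℤ
        coeff₁ s t = t * p + (s - t * p) * y
        coeff₂ s t = t * q - (s - t * p) * x

        a-parity : ∀ s t → coeff₁ s t * h ≈ s * h
        a-parity s t = same-parity s ((s - t * p) * l) (identity s (t * p) l)
          where
          identity : ∀ s r l → r + (s - r) * (1ℤ + l * + 2) ≡ s + (s - r) * l * + 2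
          identity = solve-∀

        b-parity : ∀ s t → coeff₂ s t * h ≈ t * h
        b-parity s t = same-parity t (- (t * l * γ + (s - t * p) * k)) (identity t l γ k (s - t * p))
          where
          identity : ∀ t l γ k r → t * (1ℤ - l * + 2 * γ) - r * (k * + 2) ≡ t + - (t * l * γ + r * k) * + 2
          identity = solve-∀

        t-value : ∀ s t → coeff₁ s t * x + coeff₂ s t * y ≈ t
        t-value s t = congruent (t * l * α) (trans (expand t p q (s - t * p) x y)
          (trans (bez-expand t l β γ x (α * h)) (trans (cong (λ o → t * y - t * l * + 2 * (o - α * h)) bez)
            (trans (collect t l α h) (cong (λ n → t + t * l * α * n) (sym N≡2h))))))
          where
          expand : ∀ t p q r x y → (t * p + r * y) * x + (t * q - r * x) * y ≡ t * (p * x + q * y)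
          expand = solve-∀
          bez-expand : ∀ t l β γ x z → t * (- (l * + 2 * β) * x + (1ℤ - l * + 2 * γ) * (1ℤ + l * + 2))
            ≡ t * (1ℤ + l * + 2) - t * l * + 2 * (z + β * x + γ * (1ℤ + l * + 2) - z)
          bez-expand = solve-∀
          collect : ∀ t l α h → t * (1ℤ + l * + 2) - t * l * + 2 * (1ℤ - α * h) ≡ t + t * l * α * (h * + 2)
          collect = solve-∀

      -- Three entries of a word are (a + b) h, a h and b h, and one of a, b, a + b is even.
      kleinForm-uncovered : KleinForm C h 0ℤ 1ℤ → ¬ (∃[ w ] w ∈ C × ∀ i → lookup w i ≢ 0ₘ)
      kleinForm-uncovered (kleinForm π span) (w , w∈C , nonzero) with to (span w) w∈C
      ... | a , b , eq with parity a | parity b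
      ... | inj₁ (k , refl) | _ = nonzero (π ⟨$⟩ʳ 1F) (≈0⇒≡0ₘ (≈-trans (≈-sym (eq 1F))
              (+-cong (even*h≈0 k) (≈-reflexive (ℤ.*-zeroʳ b)))))
      ... | _ | inj₁ (l , refl) = nonzero (π ⟨$⟩ʳ 2F) (≈0⇒≡0ₘ (≈-trans (≈-sym (eq 2F))
              (+-cong (≈-reflexive (ℤ.*-zeroʳ a)) (even*h≈0 l))))
      ... | inj₂ (k , refl) | inj₂ (l , refl) = nonzero (π ⟨$⟩ʳ 0F) (≈0⇒≡0ₘ (≈-trans (≈-sym (eq 0F))
              (≈-trans (≈-reflexive (identity k l h)) (even*h≈0 (1ℤ + k + l)))))
        where
        identity : ∀ k l h → (1ℤ + k * + 2) * h + (1ℤ + l * + 2) * h ≡ (1ℤ + k + l) * + 2 * h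
        identity = solve-∀

      permute∈g⇔Span : ∀ π w →
        permute π w ∈ rowSpan (g N) ⇔ Span (rowX h 0ℤ) (rowY h 1ℤ) (residues w ∘ (π ⟨$⟩ʳ_))
      permute∈g⇔Span π w = mk⇔
        (span-cong row₁ row₂ ∘ span-resp (residues-permute π w) ∘ to (rowSpan⇔Span _ _ _))
        (from (rowSpan⇔Span _ _ _) ∘ span-resp (≈-sym ∘ residues-permute π w)
          ∘ span-cong (≈-sym ∘ row₁) (≈-sym ∘ row₂))
        where
        half : residue ((N ℕ./ 2) ℕ.mod N) ≈ h
        half = ≈-trans (residue-mod (N ℕ./ 2)) (≈-reflexive (ℤ.*-cancelʳ-≡ _ h (+ 2)
          (trans (sym (ℤ.pos-* (N ℕ./ 2) 2)) (trans (cong +_ (ℕ.m/n*n≡m 2∣N)) N≡2h))))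
          where
          2∣N : 2 ℕ.∣ N
          2∣N = ∣⇒∣ᵤ {+ 2} (divides h N≡2h)

        minus-one : residue ((N ℕ.∸ 1) ℕ.mod N) ≈ -1ℤ
        minus-one = ≈-trans (residue-mod (N ℕ.∸ 1)) (congruent 1ℤ (trans (identity (+ (N ℕ.∸ 1)))
          (cong (λ n → -1ℤ + 1ℤ * n)
            (trans (sym (ℤ.pos-+ 1 (N ℕ.∸ 1))) (cong +_ (ℕ.m+[n∸m]≡n (ℕ.>-nonZero⁻¹ N)))))))
          where
          identity : ∀ z → z ≡ -1ℤ + 1ℤ * (1ℤ + z)
          identity = solve-∀

        row₁ : ∀ i → residues (lookup (g N) 0F) i ≈ rowX h 0ℤ i
        row₁ 0F = half
        row₁ 1F = half
        row₁ 2F = residue-mod 0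
        row₁ 3F = residue-mod 0
        row₁ 4F = residue-mod 0

        row₂ : ∀ i → residues (lookup (g N) 1F) i ≈ rowY h 1ℤ i
        row₂ 0F = half
        row₂ 1F = residue-mod 0
        row₂ 2F = half
        row₂ 3F = residue-mod 1
        row₂ 4F = minus-one

      kleinForm⇒≅g : KleinForm C h 0ℤ 1ℤ → C ≅ rowSpan (g N)
      kleinForm⇒≅g (kleinForm π span) = π , λ w → ⇔-sym (permute∈g⇔Span π w) ⇔-∘ span w

      ≅g⇒kleinForm : C ≅ rowSpan (g N) → KleinForm C h 0ℤ 1ℤ
      ≅g⇒kleinForm (π , iso) = kleinForm π λ w → permute∈g⇔Span π w ⇔-∘ iso w

-- Splitting into a direct sum when x and y are even.

module _ {N : ℕ} .{{_ : NonZero N}} where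

  open Residues N
  open import Relation.Binary.Reasoning.Setoid ≈-setoid

  ZeroSum : ∀ n → Code N n
  ZeroSum n w = sum (residues w) ≈ 0ℤ

  zeroSum-linear : ∀ n → IsLinear (ZeroSum n)
  zeroSum-linear n = record
    { 0-closed = sum-≈0 n (residues 0ʷ) residues-0ʷ
    ; +-closed = λ {v} {w} v∈ w∈ → begin
        sum (residues (v +ʷ w))                  ≈⟨ sum-+ v w ⟩
        sum (residues v) + sum (residues w)      ≈⟨ +-cong v∈ w∈ ⟩
        0ℤ                                       ∎
    ; ·-closed = λ a {w} w∈ → begin
        sum (residues (a ·ʷ w))                  ≈⟨ sum-· a w ⟩
        residue a * sum (residues w)             ≈⟨ *-congˡ (residue a) w∈ ⟩
        residue a * 0ℤ                           ≡⟨ ℤ.*-zeroʳ (residue a) ⟩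
        0ℤ                                       ∎
    }
    where
    sum-≈0 : ∀ n (u : Fin n → ℤ) → (∀ i → u i ≈ 0ℤ) → sum u ≈ 0ℤ
    sum-≈0 zero    u u≈0 = ≈-refl
    sum-≈0 (suc n) u u≈0 = +-cong (u≈0 zero) (sum-≈0 n (u ∘ suc) (u≈0 ∘ suc))

    sum-+ : ∀ {n} (v w : Word N n) → sum (residues (v +ʷ w)) ≈ sum (residues v) + sum (residues w)
    sum-+ []      []      = ≈-refl
    sum-+ (s ∷ v) (t ∷ w) = ≈-trans (+-cong (residue-+ₘ s t) (sum-+ v w))
      (≈-reflexive (identity (residue s) (residue t) (sum (residues v)) (sum (residues w))))
      where
      identity : ∀ a b c d → a + b + (c + d) ≡ a + c + (b + d)
      identity = solve-∀

    sum-· : ∀ {n} a (w : Word N n) → sum (residues (a ·ʷ w)) ≈ residue a * sum (residues w)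
    sum-· a []      = ≈-reflexive (sym (ℤ.*-zeroʳ (residue a)))
    sum-· a (s ∷ w) = ≈-trans (+-cong (residue-*ₘ a s) (sum-· a w))
      (≈-reflexive (sym (ℤ.*-distribˡ-+ (residue a) (residue s) (sum (residues w)))))

-- This lets congruences over ℤ/2 and ℤ/h pass through `scale` to the modulus of the direct sum.
congruent-scale : ∀ {m n a b} k → n ≡ k * m → Congruent m a b → Congruent n (k * a) (k * b)
congruent-scale {m} {b = b} k refl (congruent q refl) = congruent q (identity k b q m)
  where
  identity : ∀ k b q m → k * (b + q * m) ≡ k * b + q * (k * m)
  identity = solve-∀

-- Since 2 and h are coprime, the code splits by the Chinese remainder theorem.
even-kleinForm⇒directSum : ∀ {N} .{{_ : NonZero N}} {C : Code N 5} (h : ℕ) .{{_ : NonZero h}} {k l} →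
  N ≡ lcm 2 h → lcm 2 h ≡ h ℕ.* 2 →
  ∃[ α ] ∃[ β ] ∃[ γ ] α * + h + β * (k * + 2) + γ * (l * + 2) ≡ 1ℤ →
  KleinForm C (+ h) (k * + 2) (l * + 2) → IsDirectSum C
even-kleinForm⇒directSum {C = C} h {k} {l} refl L≡ (α , β , γ , bez) (kleinForm π span) =
  directSum {2} {h} {3} {2} (zeroSum-linear 3) (zeroSum-linear 2) (π , λ w → mk⇔ (split w) (merge w))
  where
  L = lcm 2 h
  H = + h
  module Z₂ = Residues 2
  module Zₕ = Residues h
  open Residues L
  open import Relation.Binary.Reasoning.Setoid ≈-setoid

  +L≡ : + L ≡ H * + 2
  +L≡ = trans (cong +_ L≡) (ℤ.pos-* h 2)

  L/2≡h : L ℕ./ 2 ≡ h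
  L/2≡h = trans (ℕ./-congˡ L≡) (ℕ.m*n/n≡m h 2)

  L/h≡2 : L ℕ./ h ≡ 2
  L/h≡2 = trans (ℕ./-congˡ (trans L≡ (ℕ.*-comm h 2))) (ℕ.m*n/n≡m 2 h)

  scale₂ : ∀ c → residue ((L ℕ./ 2 ℕ.* toℕ c) ℕ.mod L) ≈ H * Z₂.residue c
  scale₂ c = ≈-trans (residue-mod _) (≈-reflexive (trans (cong (λ q → + (q ℕ.* toℕ c)) L/2≡h) (ℤ.pos-* h (toℕ c))))

  scaleₕ : ∀ c → residue ((L ℕ./ h ℕ.* toℕ c) ℕ.mod L) ≈ + 2 * Zₕ.residue c
  scaleₕ c = ≈-trans (residue-mod _) (≈-reflexive (trans (cong (λ q → + (q ℕ.* toℕ c)) L/h≡2) (ℤ.pos-* 2 (toℕ c))))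

  lift₂ : ∀ {a b} → a Z₂.≈ b → H * a ≈ H * b
  lift₂ = congruent-scale H +L≡

  liftₕ : ∀ {a b} → a Zₕ.≈ b → + 2 * a ≈ + 2 * b
  liftₕ = congruent-scale (+ 2) (trans +L≡ (ℤ.*-comm H (+ 2)))

  split : ∀ w → w ∈ C → permute π w ∈ ZeroSum {2} 3 ⊕ ZeroSum {h} 2
  split w w∈C with to (span w) w∈C
  ... | a , b , eq = c₁ , c₂ , c₁∈ , c₂∈ , residues-injective λ i →
        ≈-trans (residues-permute π w i) (≈-trans (≈-sym (eq i)) (≈-sym (pieces i)))
    where
    -- The word is h (a + b , a , b) followed by 2 (t , - t): the first part depends on a and b
    -- modulo 2, the second on t modulo h.
    t = a * k + b * l
    c₁ = Z₂.class (a + b) ∷ Z₂.class a ∷ Z₂.class b ∷ []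
    c₂ = Zₕ.class t ∷ Zₕ.class (- t) ∷ []
    c₁∈ : c₁ ∈ ZeroSum {2} 3
    c₁∈ = Z₂.≈-trans
      (Z₂.+-cong (Z₂.residue-class (a + b))
        (Z₂.+-cong (Z₂.residue-class a) (Z₂.+-cong (Z₂.residue-class b) (Z₂.≈-refl {0ℤ}))))
      (congruent (a + b) (identity a b))
      where
      identity : ∀ a b → a + b + (a + (b + 0ℤ)) ≡ 0ℤ + (a + b) * + 2
      identity = solve-∀
    c₂∈ : c₂ ∈ ZeroSum {h} 2
    c₂∈ = Zₕ.≈-trans 
      (Zₕ.+-cong (Zₕ.residue-class t) (Zₕ.+-cong (Zₕ.residue-class (- t)) (Zₕ.≈-refl {0ℤ})))
      (Zₕ.≈-reflexive (identity t))
      where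
      identity : ∀ t → t + (- t + 0ℤ) ≡ 0ℤ
      identity = solve-∀
    piece₂ : ∀ z → residue ((L ℕ./ 2 ℕ.* toℕ (Z₂.class z)) ℕ.mod L) ≈ H * z
    piece₂ z = ≈-trans (scale₂ _) (lift₂ (Z₂.residue-class z))
    pieceₕ : ∀ z → residue ((L ℕ./ h ℕ.* toℕ (Zₕ.class z)) ℕ.mod L) ≈ + 2 * z
    pieceₕ z = ≈-trans (scaleₕ _) (liftₕ (Zₕ.residue-class z))
    identity₀ : ∀ a b H → H * (a + b) ≡ a * H + b * H
    identity₀ = solve-∀
    identity₁ : ∀ a b H → H * a ≡ a * H + b * 0ℤ
    identity₁ = solve-∀
    identity₂ : ∀ a b H → H * b ≡ a * 0ℤ + b * H
    identity₂ = solve-∀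
    identity₃ : ∀ a b k l → + 2 * (a * k + b * l) ≡ a * (k * + 2) + b * (l * + 2)
    identity₃ = solve-∀
    identity₄ : ∀ a b k l → + 2 * - (a * k + b * l) ≡ a * - (k * + 2) + b * - (l * + 2)
    identity₄ = solve-∀
    pieces : ∀ i → residues (scale L c₁ Vec.++ scale L c₂) i ≈ a * rowX H (k * + 2) i + b * rowY H (l * + 2) i
    pieces 0F = ≈-trans (piece₂ (a + b)) (≈-reflexive (identity₀ a b H))
    pieces 1F = ≈-trans (piece₂ a) (≈-reflexive (identity₁ a b H))
    pieces 2F = ≈-trans (piece₂ b) (≈-reflexive (identity₂ a b H))
    pieces 3F = ≈-trans (pieceₕ t) (≈-reflexive (identity₃ a b k l))
    pieces 4F = ≈-trans (pieceₕ (- t)) (≈-reflexive (identity₄ a b k l))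

  merge : ∀ w → permute π w ∈ ZeroSum {2} 3 ⊕ ZeroSum {h} 2 → w ∈ C
  merge w (c₁@(p₀ ∷ q₀ ∷ r₀ ∷ []) , c₂@(s₀ ∷ s₁ ∷ []) , c₁∈ , c₂∈ , eq) =
    from (span w) (a , b , λ i → ≈-trans (pieces i)
      (≈-trans (≈-reflexive (cong (λ w → residues w i) (sym eq))) (residues-permute π w i)))
    where
    p = Z₂.residue p₀
    q = Z₂.residue q₀
    r = Z₂.residue r₀
    s = Zₕ.residue s₀
    s′ = Zₕ.residue s₁
    -- α h is 1 modulo 2 and 0 modulo h, while 2 (β k + γ l) = 1 - α h is 0 modulo 2 and 1 modulo h.
    a = α * H * q + β * + 2 * s
    b = α * H * r + γ * + 2 * s

    αH≡ : α * H ≡ 1ℤ - (β * k + γ * l) * + 2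
    αH≡ = trans (identity (α * H) β γ k l) (cong (_- (β * k + γ * l) * + 2) bez)
      where
      identity : ∀ z β γ k l → z ≡ z + β * (k * + 2) + γ * (l * + 2) - (β * k + γ * l) * + 2
      identity = solve-∀

    a≈q : a Z₂.≈ q
    a≈q = congruent (β * s - (β * k + γ * l) * q)
      (trans (cong (λ z → z * q + β * + 2 * s) αH≡) (identity (β * k + γ * l) q β s))
      where
      identity : ∀ z q β s → (1ℤ - z * + 2) * q + β * + 2 * s ≡ q + (β * s - z * q) * + 2
      identity = solve-∀

    b≈r : b Z₂.≈ r
    b≈r = congruent (γ * s - (β * k + γ * l) * r)
      (trans (cong (λ z → z * r + γ * + 2 * s) αH≡) (identity (β * k + γ * l) r γ s))
      where
      identity : ∀ z q β s → (1ℤ - z * + 2) * q + β * + 2 * s ≡ q + (β * s - z * q) * + 2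
      identity = solve-∀

    -- The zero sum gives p ≡ - (q + r), and signs do not matter modulo 2.
    a+b≈p : a + b Z₂.≈ p
    a+b≈p = Z₂.≈-trans (Z₂.+-cong a≈q b≈r) (Z₂.≈-trans (Z₂.≈-sym (Z₂.≈0⇒+≈ (q + r) c₁∈))
      (congruent (q + r) (identity p q r)))
      where
      identity : ∀ p q r → p + (q + (r + 0ℤ)) + (q + r) ≡ p + (q + r) * + 2
      identity = solve-∀

    t≈s : a * k + b * l Zₕ.≈ s
    t≈s = congruent (α * (q * k + r * l - s)) (trans (identity (α * H) β γ q r s k l)
      (trans (cong (λ o → s * o + (α * H) * (q * k + r * l - s)) bez) (identity′ s α H (q * k + r * l - s))))
      where
      identity : ∀ z β γ q r s k l → (z * q + β * + 2 * s) * k + (z * r + γ * + 2 * s) * l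
        ≡ s * (z + β * (k * + 2) + γ * (l * + 2)) + z * (q * k + r * l - s)
      identity = solve-∀
      identity′ : ∀ s α H z → s * 1ℤ + (α * H) * z ≡ s + α * z * H
      identity′ = solve-∀

    -t≈s′ : -1ℤ * (a * k + b * l) Zₕ.≈ s′
    -t≈s′ = Zₕ.≈-trans (Zₕ.*-congˡ -1ℤ t≈s) (Zₕ.≈-trans (Zₕ.≈-sym (Zₕ.≈0⇒+≈ (-1ℤ * s) c₂∈))
      (Zₕ.≈-reflexive (identity s s′)))
      where
      identity : ∀ s s′ → s + (s′ + 0ℤ) + -1ℤ * s ≡ s′
      identity = solve-∀

    identity₀ : ∀ a b H → a * H + b * H ≡ H * (a + b)
    identity₀ = solve-∀
    identity₁ : ∀ a b H → a * H + b * 0ℤ ≡ H * a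
    identity₁ = solve-∀
    identity₂ : ∀ a b H → a * 0ℤ + b * H ≡ H * b
    identity₂ = solve-∀
    identity₃ : ∀ a b k l → a * (k * + 2) + b * (l * + 2) ≡ + 2 * (a * k + b * l)
    identity₃ = solve-∀
    identity₄ : ∀ a b k l → a * - (k * + 2) + b * - (l * + 2) ≡ + 2 * (-1ℤ * (a * k + b * l))
    identity₄ = solve-∀
    pieces : ∀ i → a * rowX H (k * + 2) i + b * rowY H (l * + 2) i ≈ residues (scale L c₁ Vec.++ scale L c₂) i
    pieces 0F = ≈-trans (≈-reflexive (identity₀ a b H)) (≈-trans (lift₂ a+b≈p) (≈-sym (scale₂ p₀)))
    pieces 1F = ≈-trans (≈-reflexive (identity₁ a b H)) (≈-trans (lift₂ a≈q) (≈-sym (scale₂ q₀)))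
    pieces 2F = ≈-trans (≈-reflexive (identity₂ a b H)) (≈-trans (lift₂ b≈r) (≈-sym (scale₂ r₀)))
    pieces 3F = ≈-trans (≈-reflexive (identity₃ a b k l)) (≈-trans (liftₕ t≈s) (≈-sym (scaleₕ s₀)))
    pieces 4F = ≈-trans (≈-reflexive (identity₄ a b k l)) (≈-trans (liftₕ -t≈s′) (≈-sym (scaleₕ s₁)))

-- A common divisor of 2 and h divides the left side of the Bézout relation, hence 1.
lcm-2-odd : ∀ {h k l} →
  (∃[ α ] ∃[ β ] ∃[ γ ] α * + h + β * (k * + 2) + γ * (l * + 2) ≡ 1ℤ) → lcm 2 h ≡ h ℕ.* 2
lcm-2-odd {h} {k} {l} (α , β , γ , bez) = trans (sym (ℕ.*-identityˡ (lcm 2 h)))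
  (trans (cong (ℕ._* lcm 2 h) (sym gcd≡1)) (trans (gcd*lcm 2 h) (ℕ.*-comm 2 h)))
  where
  d = ℕ.gcd 2 h
  d∣2 : + d ∣ᶻ + 2
  d∣2 = ∣ᵤ⇒∣ (ℕ.gcd[m,n]∣m 2 h)
  d∣1 : + d ∣ᶻ 1ℤ
  d∣1 = subst (+ d ∣ᶻ_) bez (∣m∣n⇒∣m+n (∣m∣n⇒∣m+n (∣n⇒∣m*n α (∣ᵤ⇒∣ (ℕ.gcd[m,n]∣n 2 h)))
    (∣n⇒∣m*n β (∣n⇒∣m*n k d∣2))) (∣n⇒∣m*n γ (∣n⇒∣m*n l d∣2)))
  gcd≡1 : d ≡ 1
  gcd≡1 = ℕ.∣1⇒≡1 (∣⇒∣ᵤ d∣1)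

-- The parity cases and the classification.

module _ {N : ℕ} .{{_ : NonZero N}} {C : Code N 5} (adm : Admissible C) (indecomposable : ¬ IsDirectSum C) where

  kleinForm⇒normal : ∀ {h x y} → + N ≡ h * + 2 → KleinForm C h x y → KleinForm C h 0ℤ 1ℤ
  kleinForm⇒normal {h} {x} {y} N≡2h form with parity x | parity y
  ... | inj₁ (k , x≡) | inj₂ (l , y≡) = kleinForm-normalise N≡2h k l x≡ y≡ (bezout-kleinForm N≡2h form adm) form
  ... | inj₂ (k , x≡) | inj₁ (l , y≡) = kleinForm-normalise N≡2h l k y≡ x≡ (bezout-kleinForm N≡2h form′ adm) form′
    where form′ = kleinForm-swap form
  -- Both odd: adding the second row to the first makes x even and keeps y odd.
  ... | inj₂ (k , refl) | inj₂ (l , refl) =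
    kleinForm-normalise N≡2h (1ℤ + k + l) l (identity k l) refl (bezout-kleinForm N≡2h form′ adm) form′
    where
    form′ = kleinForm-add N≡2h form
    identity : ∀ k l → 1ℤ + k * + 2 + (1ℤ + l * + 2) ≡ (1ℤ + k + l) * + 2
    identity = solve-∀
  ... | inj₁ (k , refl) | inj₁ (l , refl) = contradiction
    (even-kleinForm⇒directSum ∣ h ∣ {{h≢0}} {k} {l} (trans N≡h*2 (sym lcm≡)) lcm≡ bez
      (subst (λ h → KleinForm C h (k * + 2) (l * + 2)) h≡ form))
    indecomposable
    where
    N≡h*2 : N ≡ ∣ h ∣ ℕ.* 2
    N≡h*2 = trans (cong ∣_∣ N≡2h) (ℤ.abs-* h (+ 2))
    -- The integer h is half of N, so it is its own absolute value and can serve as a modulus.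
    h≡ : h ≡ + ∣ h ∣
    h≡ = ℤ.*-cancelʳ-≡ h (+ ∣ h ∣) (+ 2) (trans (sym N≡2h) (trans (cong +_ N≡h*2) (ℤ.pos-* ∣ h ∣ 2)))
    h≢0 : NonZero ∣ h ∣
    h≢0 = ℕ.≢-nonZero λ h≡0 → ℕ.≢-nonZero⁻¹ N (trans N≡h*2 (cong (ℕ._* 2) h≡0))
    bez = subst (λ h → ∃[ α ] ∃[ β ] ∃[ γ ] α * h + β * (k * + 2) + γ * (l * + 2) ≡ 1ℤ) h≡
            (bezout-kleinForm N≡2h form adm)
    lcm≡ : lcm 2 ∣ h ∣ ≡ ∣ h ∣ ℕ.* 2
    lcm≡ = lcm-2-odd {∣ h ∣} {k} {l} bez

proposition3p4 : (N : ℕ) .{{_ : NonZero N}} → 9 ≤ N →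
    (C : Code N 5) → IsLinear C → Admissible C →
    (∃[ M ] IsGeneratingMatrix {m = 2} M C) →
    ¬ Degenerate C → ¬ IsDirectSum C →
    Thin C ⇔ (2 ∣ N × C ≅ rowSpan (g N))
proposition3p4 N 9≤N C _ adm@(ext , _) (r ∷ s ∷ [] , C⊆ , ⊆C)
  nondegenerate indecomposable = mk⇔ forward backward
  where
  open Residues N

  span : ∀ w → w ∈ C ⇔ Span (residues r) (residues s) (residues w)
  span w = mk⇔ (to (rowSpan⇔Span r s w) ∘ C⊆) (⊆C ∘ from (rowSpan⇔Span r s w))

  covering : Thin C → Covering (+ N) (λ i → residues r i , residues s i)
  covering = thin⇒covering {C = C} {residues r} {residues s} span nondegenerate

  fromTriple : Thin C → KleinTriple (+ N) (λ i → residues r i , residues s i) →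
               2 ∣ N × C ≅ rowSpan (g N)
  fromTriple thin triple =
    let h , _ , _ , N≡2h , form =
          kleinTriple⇒kleinForm {C = C} {residues r} {residues s} span ext (covering thin) triple
    in  ∣⇒∣ᵤ {+ 2} (divides h N≡2h) , kleinForm⇒≅g N≡2h (kleinForm⇒normal adm indecomposable N≡2h form)

  forward : Thin C → 2 ∣ N × C ≅ rowSpan (g N)
  forward thin = [ fromTriple thin
    , (λ bound → contradiction (bounded⇒N≤8 {C = C} {residues r} {residues s} span adm bound)
                               (ℕ.<⇒≱ 9≤N)) ]′
    (covering-classification (covering thin))

  backward : 2 ∣ N × C ≅ rowSpan (g N) → Thin C
  backward (2∣N , iso) with ∣ᵤ⇒∣ {+ 2} {+ N} 2∣N
  ... | divides h N≡2h = ext , kleinForm-uncovered {h = h} N≡2h (≅g⇒kleinForm N≡2h iso)
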